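{- Let $C_1=\sum_{P} q^{\text{area of }P}$, where the sum runs over all level one cheesy polyominoes $P$ (on the hexagonal tiling, counted up to translation). Then, as a formal power series in $q$, $$C_1=\frac{q(1-3q+q^2)}{1-6q+8q^2-q^3}.$$
   Context: Consider the regular hexagonal tiling of the Euclidean plane, oriented so that every hexagonal tile has two horizontal edges; tiles are called cells. A (hexagonal-celled) polyomino is a union of finitely many (at least one) cells whose interior is connected (for unions of hexagonal cells, this is equivalent to the union being connected). Two polyominoes are considered equal if and only if one is the image of the other under a translation. The area of a polyomino is its number of cells. The cells of a polyomino $P$ are partitioned according to their horizontal projection (cells with the same projection onto the horizontal axis lie in the same block); each block is a column of $P$. Cells of the tiling with the same horizontal projection are stacked vertically, consecutive ones sharing a horizontal edge. A column need not be a connected set; its connected components are its maximal runs of vertically consecutive cells. If a column has two connected components, the gap (hole) between them is the set of cells of the tiling lying in that vertical stack strictly between the two components. Columns are ordered from left to right; the first column is the leftmost one, and two columns are adjacent if they are consecutive in this order. A polyomino $P$ is rightward-semi-directed if the first (leftmost) column of $P$ has no gap (i.e. is connected) and, in every pair of adjacent columns of $P$, every connected component of the right column has at least one edge in common with the left column. For an integer $m\ge 1$, a polyomino $P$ is a level $m$ cheesy polyomino if: (i) $P$ is rightward-semi-directed; (ii) every column of $P$ has at most two connected components; (iii) if a column of $P$ has two connected components, then the gap between the components consists of at most $m$ cells. -}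

module Defs where

open import Algebra.Properties.Monoid.Sum using ()
open import Data.Fin.Base using (Fin; toℕ)
open import Data.Integer.Base using (ℤ; +_; -_; _+_; _*_; _≤_; _<_; 0ℤ; 1ℤ; -1ℤ)
open import Data.Integer.Properties
  using (+-0-monoid; +-assoc; +-identityˡ; +-inverseˡ)
open import Data.List.Base using (List; []; _∷_; length; map)
open import Data.List.Membership.Propositional using (_∈_; _∉_)
open import Data.List.Properties using (map-id; map-∘; map-cong)
open import Data.List.Relation.Binary.BagAndSetEquality as BagSet
  using (_∼[_]_; set; [_]-Equality)
open import Data.List.Relation.Unary.All using (All)
open import Data.List.Relation.Unary.Unique.Propositional using (Unique)
open import Data.Nat.Base as ℕ using (ℕ; zero; suc; _∸_)
open import Data.Product.Base using (∃₂; ∃-syntax; _×_; _,_; proj₁)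
open import Function.Base using (id)
open import Function.Bundles using (Inverse)
open import Level using (Level; 0ℓ)
open import Relation.Binary.Bundles using (Setoid)
import Relation.Binary.Construct.On as On
open import Relation.Binary.Construct.Closure.ReflexiveTransitive using (Star)
open import Relation.Binary.PropositionalEquality as ≡
  using (_≡_; _≢_; _≗_; refl; sym; trans; cong; cong₂)
open import Relation.Nullary using (¬_)

private
  variable
    a p ℓ : Level

------------------------------------------------------------------------
-- Cells

-- Cells are given by axial coordinates: (i , j) is the hexagon (of side 1)
-- centred at (3i/2 , √3 (j + i/2)).  The first coordinate is thus
-- determined by the horizontal projection of the cell, consecutive j are
-- stacked on each other, and the translations preserving the tiling are
-- exactly the additions of elements of ℤ × ℤ.
Cell : Set
Cell = ℤ × ℤ

infixl 6 _⊕_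

_⊕_ : Cell → Cell → Cell
(i , j) ⊕ (i′ , j′) = (i + i′ , j + j′)

directions : List Cell
directions =
  (0ℤ , 1ℤ) ∷ (0ℤ , -1ℤ) ∷
  (1ℤ , 0ℤ) ∷ (1ℤ , -1ℤ) ∷
  (-1ℤ , 0ℤ) ∷ (-1ℤ , 1ℤ) ∷ []

-- Two distinct cells with a common edge.
Adjacent : Cell → Cell → Set
Adjacent c d = ∃[ v ] v ∈ directions × d ≡ v ⊕ c

------------------------------------------------------------------------
-- Polyominoes

Connected : List Cell → Set
Connected cs =
  ∀ {c d} → c ∈ cs → d ∈ cs → Star (λ x y → y ∈ cs × Adjacent x y) c d

-- The order of the list is immaterial: see _≈_ below.
record Polyomino : Set where
  field
    cells     : List Cell
    unique    : Unique cells
    nonEmpty  : cells ≢ []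
    connected : Connected cells

open Polyomino public

area : Polyomino → ℕ
area P = length (cells P)

infix 4 _≈_

-- Some translation maps P onto Q.
_≈_ : Polyomino → Polyomino → Set
P ≈ Q = ∃[ t ] map (t ⊕_) (cells P) ∼[ set ] cells Q

private
  module SetEq = Setoid ([ set ]-Equality Cell)

  ⊕-assoc : ∀ s t c → (s ⊕ t) ⊕ c ≡ s ⊕ (t ⊕ c)
  ⊕-assoc (s₁ , s₂) (t₁ , t₂) (c₁ , c₂) =
    cong₂ _,_ (+-assoc s₁ t₁ c₁) (+-assoc s₂ t₂ c₂)

  ⊕-identityˡ : ∀ c → (0ℤ , 0ℤ) ⊕ c ≡ c
  ⊕-identityˡ (c₁ , c₂) = cong₂ _,_ (+-identityˡ c₁) (+-identityˡ c₂)

  ⊖_ : Cell → Cell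
  ⊖ (t₁ , t₂) = (- t₁ , - t₂)

  ⊖-cancel : ∀ t c → (⊖ t) ⊕ (t ⊕ c) ≡ c
  ⊖-cancel t@(t₁ , t₂) c = trans (sym (⊕-assoc (⊖ t) t c))
    (trans (cong (_⊕ c) (cong₂ _,_ (+-inverseˡ t₁) (+-inverseˡ t₂)))
           (⊕-identityˡ c))

  map-identity : ∀ {f : Cell → Cell} → f ≗ id → ∀ cs → map f cs ≡ cs
  map-identity f≗id cs = trans (map-cong f≗id cs) (map-id cs)

≈-refl : ∀ {P} → P ≈ P
≈-refl {P} =
  (0ℤ , 0ℤ) , SetEq.reflexive (map-identity ⊕-identityˡ (cells P))

≈-sym : ∀ {P Q} → P ≈ Q → Q ≈ P
≈-sym {P} {Q} (t , P+t∼Q) = ⊖ t , SetEq.trans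
  (SetEq.sym (BagSet.map-cong {f = (⊖ t) ⊕_} (λ _ → refl) P+t∼Q))
  (SetEq.reflexive (trans (sym (map-∘ (cells P)))
                          (map-identity (⊖-cancel t) (cells P))))

≈-trans : ∀ {P Q R} → P ≈ Q → Q ≈ R → P ≈ R
≈-trans {P} {Q} {R} (t , P+t∼Q) (s , Q+s∼R) = s ⊕ t , SetEq.trans
  (SetEq.reflexive (trans (map-cong (⊕-assoc s t) (cells P))
                          (map-∘ (cells P))))
  (SetEq.trans (BagSet.map-cong {f = s ⊕_} (λ _ → refl) P+t∼Q) Q+s∼R)

polyominoSetoid : Setoid 0ℓ 0ℓ
polyominoSetoid = record
  { Carrier       = Polyomino
  ; _≈_           = _≈_
  ; isEquivalence = record
    { refl  = λ {P} → ≈-refl {P}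
    ; sym   = λ {P} {Q} → ≈-sym {P} {Q}
    ; trans = λ {P} {Q} {R} → ≈-trans {P} {Q} {R}
    }
  }

------------------------------------------------------------------------
-- Cheesy polyominoes

-- At most k elements of A satisfy P.
AtMost : {A : Set a} → ℕ → (A → Set p) → Set _
AtMost k P = ∀ xs → Unique xs → All P xs → length xs ℕ.≤ k

module _ (P : Polyomino) where

  HasColumn : ℤ → Set
  HasColumn i = ∃[ j ] (i , j) ∈ cells P

  FirstColumn : ℤ → Set
  FirstColumn i = HasColumn i × (∀ i′ → HasColumn i′ → i ≤ i′)

  AdjacentColumns : ℤ → ℤ → Set
  AdjacentColumns i i′ =
    HasColumn i × HasColumn i′ × i < i′ ×
    (∀ k → i < k → k < i′ → ¬ HasColumn k)

  -- The cells (i , j) with lo ≤ j ≤ hi form a connected component of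
  -- column i.
  Component : ℤ → ℤ × ℤ → Set
  Component i (lo , hi) =
    lo ≤ hi ×
    (∀ j → lo ≤ j → j ≤ hi → (i , j) ∈ cells P) ×
    (i , lo + -1ℤ) ∉ cells P ×
    (i , hi + 1ℤ) ∉ cells P

  RightwardSemiDirected : Set
  RightwardSemiDirected =
    (∀ i → FirstColumn i → AtMost 1 (Component i)) ×
    (∀ i i′ → AdjacentColumns i i′ →
     ∀ lo hi → Component i′ (lo , hi) →
     ∃₂ λ j k → lo ≤ j × j ≤ hi ×
                (i , k) ∈ cells P × Adjacent (i′ , j) (i , k))

  record Cheesy (m : ℕ) : Set where
    field
      semiDirected : RightwardSemiDirected
      components≤2 : ∀ i → AtMost 2 (Component i)
      gap≤m        : ∀ i lo₁ hi₁ lo₂ hi₂ →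
                     Component i (lo₁ , hi₁) → Component i (lo₂ , hi₂) →
                     hi₁ < lo₂ → AtMost m (λ j → hi₁ < j × j < lo₂)

cheesySetoid : ℕ → ℕ → Setoid 0ℓ 0ℓ
cheesySetoid m n =
  On.setoid polyominoSetoid
    (proj₁ {B = λ P → Cheesy P m × area P ≡ n})

------------------------------------------------------------------------
-- Formal power series with integer coefficients

Series : Set
Series = ℕ → ℤ

infixl 7 _⊛_

_⊛_ : Series → Series → Series
(f ⊛ g) n = ∑[ i ≤ n ] (f (toℕ i) * g (n ∸ toℕ i))
  where open Algebra.Properties.Monoid.Sum +-0-monoid

-- The polynomial with the given coefficients, constant term first.
poly : List ℤ → Series
poly []       _       = 0ℤ
poly (a ∷ as) zero    = a
poly (a ∷ as) (suc n) = poly as n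

infix 4 _≗_/_

-- Equality with a quotient of power series, whose denominator must have
-- an invertible constant term for the quotient to exist (and then it is
-- unique).
_≗_/_ : Series → Series → Series → Set
f ≗ g / h = (h 0 * h 0 ≡ 1ℤ) × (h ⊛ f ≗ g)

HasCardinality : Setoid a ℓ → ℕ → Set _
HasCardinality S k = Inverse S (≡.setoid (Fin k))

-- f is Σ qⁿ |S n|; in particular each S n is finite.
IsGeneratingFunction : (ℕ → Setoid a ℓ) → Series → Set _
IsGeneratingFunction S f = ∀ n → ∃[ k ] HasCardinality (S n) k × f n ≡ + k

{-# OPTIONS --safe #-}
-- If the lowest and the highest cell of a column are lo and lo + s and the
-- column has a hole of at most one cell, the cells of the next column with an
-- edge in common with it are those from lo - 1 to lo + s, whether or not there
-- is a hole.  So a level one cheesy polyomino amounts to the height of its first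
-- column followed by a sequence of columns, each given by its shape and by a
-- position: x + 1 contiguous cells have s + x + 2 admissible positions, and the
-- hole of a holed column has s.  The number of ways to complete a polyomino by n
-- cells is therefore affine in s, with coefficients obeying a linear recurrence.
module Submission where

open import Defs
open import Data.Bool.Base using (Bool; true; false; T; _∧_)
open import Data.Bool.Properties using (T-∧)
open import Data.Empty using (⊥; ⊥-elim)
open import Data.Fin.Base as Fin using (Fin; toℕ)
import Data.Fin.Properties as Fin
open import Data.Integer.Base
  using (ℤ; +_; -[1+_]; -_; _+_; _-_; _*_; _≤_; _<_; 0ℤ; 1ℤ; -1ℤ; +≤+; +<+; -≤+; ∣_∣)
import Data.Integer.Properties as ℤ
open import Data.Integer.Tactic.RingSolver using (solve-∀)
open import Data.List.Base
  using (List; []; _∷_; _++_; length; map; lookup; applyUpTo; allFin; cartesianProductWith)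
open import Data.List.Membership.Propositional using (_∈_; _∉_; find; lose)
open import Data.List.Membership.Propositional.Properties
  using (∈-applyUpTo⁺; ∈-applyUpTo⁻; ∈-++⁺ˡ; ∈-++⁺ʳ; ∈-++⁻; ∈-map⁺; ∈-map⁻; ∈-allFin; ∈-lookup;
         ∈-cartesianProductWith⁺; ∈-cartesianProductWith⁻)
open import Data.List.Membership.Propositional.Properties.WithK using (unique∧set⇒bag)
open import Data.List.Properties
  using (length-++; length-applyUpTo; length-map; length-tabulate; map-++; map-applyUpTo)
open import Data.List.Relation.Binary.BagAndSetEquality using (_∼[_]_; set; ∼bag⇒↭)
open import Data.List.Relation.Binary.Permutation.Propositional.Properties using (↭-length)
open import Data.List.Relation.Unary.All as All using ([]; _∷_)
open import Data.List.Relation.Unary.AllPairs using ([]; _∷_)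
open import Data.List.Relation.Unary.Any as Any using (Any; here; there; any?)
open import Data.List.Relation.Unary.Any.Properties using (lookup-index)
open import Data.List.Relation.Unary.Unique.Propositional using (Unique)
import Data.List.Relation.Unary.Unique.Propositional.Properties as Unique
open import Data.Nat.Base as ℕ using (ℕ; zero; suc)
import Data.Nat.Properties as ℕ
import Data.Nat.Tactic.RingSolver as ℕ-Solver
open import Data.Product.Base using (Σ; ∃₂; ∃-syntax; _×_; _,_; proj₁; proj₂; map₂)
import Data.Product.Properties as ×
open import Data.Sum.Base as Sum using (_⊎_; inj₁; inj₂; [_,_]′)
open import Data.Unit.Base using (⊤; tt)
open import Data.Vec.Base as Vec using (Vec; []; _∷_)
open import Data.Vec.N-ary using (N-ary; _$ⁿ_)
open import Function.Base using (id; _∘_; case_of_)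
open import Function.Bundles using (Equivalence; _⇔_; mk⇔)
open import Relation.Binary.Bundles using (Setoid)
open import Relation.Binary.Construct.Closure.ReflexiveTransitive as Star using (Star; ε; _◅_; _◅◅_)
open import Relation.Binary.PropositionalEquality
  using (_≡_; _≢_; _≗_; refl; sym; trans; cong; cong₂; subst; module ≡-Reasoning)
open import Relation.Nullary using (¬_; yes; no; contradiction)
open import Relation.Unary using (Decidable)
open import Algebra.Properties.AbelianGroup ℤ.+-0-abelianGroup using (∙-cancelˡ)
open import Algebra.Properties.Monoid.Sum ℤ.+-0-monoid using (sum-replicate-zero)
open import Data.List.Membership.DecPropositional (×.≡-dec ℤ._≟_ ℤ._≟_) using (_∈?_)

-- Linear arithmetic over ℤ, checked by evaluation

-- The left neighbours of the cell `(1ℤ + i , j)` are `(i , j)` and `(i , 1ℤ + j)`. They are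
-- consecutive, so a hole of one cell never contains both; a hole of two cells can, and the interval
-- of touching cells would break. That interval has s + 2 heights, and x + 1 contiguous cells meet
-- it in (s + 2) + (x + 1) - 1 positions. The two parts of a holed column end and begin next to the
-- hole and must both meet it, which confines the hole to the heights from lo to lo + s - 1,
-- whatever the sizes of the parts. The obstacle is that a polyomino is a list of cells up to order
-- and translation. `Layout` therefore ties a list to a code by membership alone: that a layout
-- exists for every cheesy polyomino, is unique and survives translation gives the bijection with
-- codes. Sums over column heights are avoided by moving cells one at a time from the rest of the
-- polyomino into the current column, so that counting is a structural recursion with polynomial
-- closed forms. The resulting 3 by 3 recurrence has characteristic polynomial λ³ - 6λ² + 8λ - 1,
-- whose reversal is the denominator.

infixl 6 _:+_ _:-_
infix 4 _:≤_ _:<_ _:≡_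
infixr 3 _⇒_

data Expr (n : ℕ) : Set where
  var : Fin n → Expr n
  con : ℤ → Expr n
  _:+_ _:-_ : Expr n → Expr n → Expr n

data Fact (n : ℕ) : Set where
  _:≤_ _:<_ _:≡_ : Expr n → Expr n → Fact n

data Sequent (n : ℕ) : Set where
  _⇒_ : Fact n → Sequent n → Sequent n
  ∴≤ ∴< : Expr n → Expr n → Sequent n
  ∴⊥ : Sequent n

⟦_⟧ : ∀ {n} → Expr n → Vec ℤ n → ℤ
⟦ var i ⟧ ρ = Vec.lookup ρ i
⟦ con c ⟧ ρ = c
⟦ a :+ b ⟧ ρ = ⟦ a ⟧ ρ + ⟦ b ⟧ ρ
⟦ a :- b ⟧ ρ = ⟦ a ⟧ ρ - ⟦ b ⟧ ρ

⟦_⟧ᶠ : ∀ {n} → Fact n → Vec ℤ n → Set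
⟦ a :≤ b ⟧ᶠ ρ = ⟦ a ⟧ ρ ≤ ⟦ b ⟧ ρ
⟦ a :< b ⟧ᶠ ρ = ⟦ a ⟧ ρ < ⟦ b ⟧ ρ
⟦ a :≡ b ⟧ᶠ ρ = ⟦ a ⟧ ρ ≡ ⟦ b ⟧ ρ

⟦_⟧ˢ : ∀ {n} → Sequent n → Vec ℤ n → Set
⟦ h ⇒ s ⟧ˢ ρ = ⟦ h ⟧ᶠ ρ → ⟦ s ⟧ˢ ρ
⟦ ∴≤ a b ⟧ˢ ρ = ⟦ a ⟧ ρ ≤ ⟦ b ⟧ ρ
⟦ ∴< a b ⟧ˢ ρ = ⟦ a ⟧ ρ < ⟦ b ⟧ ρ
⟦ ∴⊥ ⟧ˢ ρ = ⊥

-- Integrality turns a strict inequality into one with slack smaller by one. An equation yields only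
-- `a ≤ b`, so a caller that wants the other direction passes `sym`.
slack : ∀ {n} → Fact n → Expr n
slack (a :≤ b) = b :- a
slack (a :< b) = b :- a :- con 1ℤ
slack (a :≡ b) = b :- a

-- A sequent follows when the slack of its conclusion exceeds the sum of
-- the slacks of its hypotheses by a nonnegative constant.
excess : ∀ {n} → Sequent n → Expr n
excess (h ⇒ s) = excess s :- slack h
excess (∴≤ a b) = slack (a :≤ b)
excess (∴< a b) = slack (a :< b)
excess ∴⊥ = con -1ℤ

dot : ∀ {n} → Vec ℤ n → Vec ℤ n → ℤ
dot [] [] = 0ℤ
dot (c ∷ cs) (x ∷ xs) = c * x + dot cs xs

unit : ∀ {n} → Fin n → Vec ℤ n
unit Fin.zero = 1ℤ ∷ Vec.replicate _ 0ℤ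
unit (Fin.suc i) = 0ℤ ∷ unit i

constant : ∀ {n} → Expr n → ℤ
constant (var i) = 0ℤ
constant (con c) = c
constant (a :+ b) = constant a + constant b
constant (a :- b) = constant a - constant b

coefficients : ∀ {n} → Expr n → Vec ℤ n
coefficients (var i) = unit i
coefficients (con c) = Vec.replicate _ 0ℤ
coefficients (a :+ b) = Vec.zipWith _+_ (coefficients a) (coefficients b)
coefficients (a :- b) = Vec.zipWith _-_ (coefficients a) (coefficients b)

dot-0 : ∀ {n} (ρ : Vec ℤ n) → dot (Vec.replicate _ 0ℤ) ρ ≡ 0ℤ
dot-0 [] = refl
dot-0 (x ∷ ρ) = cong₂ _+_ (ℤ.*-zeroˡ x) (dot-0 ρ)

dot-unit : ∀ {n} (i : Fin n) ρ → dot (unit i) ρ ≡ Vec.lookup ρ i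
dot-unit Fin.zero (x ∷ ρ) =
  trans (cong₂ _+_ (ℤ.*-identityˡ x) (dot-0 ρ)) (ℤ.+-identityʳ x)
dot-unit (Fin.suc i) (x ∷ ρ) =
  trans (cong₂ _+_ (ℤ.*-zeroˡ x) (dot-unit i ρ)) (ℤ.+-identityˡ _)

dot-+ : ∀ {n} (as bs ρ : Vec ℤ n) →
        dot (Vec.zipWith _+_ as bs) ρ ≡ dot as ρ + dot bs ρ
dot-+ [] [] [] = refl
dot-+ (a ∷ as) (b ∷ bs) (x ∷ ρ) =
  trans (cong (_+_ ((a + b) * x)) (dot-+ as bs ρ)) (rearrange a b x _ _)
  where
  rearrange : ∀ a b x u v → (a + b) * x + (u + v) ≡ a * x + u + (b * x + v)
  rearrange = solve-∀

dot-- : ∀ {n} (as bs ρ : Vec ℤ n) →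
        dot (Vec.zipWith _-_ as bs) ρ ≡ dot as ρ - dot bs ρ
dot-- [] [] [] = refl
dot-- (a ∷ as) (b ∷ bs) (x ∷ ρ) =
  trans (cong (_+_ ((a - b) * x)) (dot-- as bs ρ)) (rearrange a b x _ _)
  where
  rearrange : ∀ a b x u v → (a - b) * x + (u - v) ≡ a * x + u - (b * x + v)
  rearrange = solve-∀

normal-form : ∀ {n} (e : Expr n) ρ →
              ⟦ e ⟧ ρ ≡ constant e + dot (coefficients e) ρ
normal-form (var i) ρ = sym (trans (ℤ.+-identityˡ _) (dot-unit i ρ))
normal-form (con c) ρ =
  sym (trans (cong (_+_ c) (dot-0 ρ)) (ℤ.+-identityʳ c))
normal-form (a :+ b) ρ
  rewrite normal-form a ρ | normal-form b ρ
        | dot-+ (coefficients a) (coefficients b) ρ = rearrange (constant a) _ _ _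
  where
  rearrange : ∀ a u b v → a + u + (b + v) ≡ a + b + (u + v)
  rearrange = solve-∀
normal-form (a :- b) ρ
  rewrite normal-form a ρ | normal-form b ρ
        | dot-- (coefficients a) (coefficients b) ρ = rearrange (constant a) _ _ _
  where
  rearrange : ∀ a u b v → a + u - (b + v) ≡ a - b + (u - v)
  rearrange = solve-∀

isZero isNonNegative : ℤ → Bool
isZero (+ zero) = true
isZero _        = false
isNonNegative (+ _)    = true
isNonNegative -[1+ _ ] = false

allZero : ∀ {n} → Vec ℤ n → Bool
allZero [] = true
allZero (c ∷ cs) = isZero c ∧ allZero cs

allZero⇒dot≡0 : ∀ {n} (cs ρ : Vec ℤ n) → T (allZero cs) → dot cs ρ ≡ 0ℤ
allZero⇒dot≡0 [] [] _ = refl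
allZero⇒dot≡0 (+ zero ∷ cs) (x ∷ ρ) z =
  cong₂ _+_ (ℤ.*-zeroˡ x) (allZero⇒dot≡0 cs ρ z)

Valid : ∀ {n} → Sequent n → Bool
Valid s = isNonNegative (constant (excess s)) ∧ allZero (coefficients (excess s))

valid⇒0≤excess : ∀ {n} (s : Sequent n) ρ → T (Valid s) → 0ℤ ≤ ⟦ excess s ⟧ ρ
valid⇒0≤excess s ρ v
  with nonNegative , zeros ← Equivalence.to (T-∧ {isNonNegative (constant (excess s))}) v
  rewrite normal-form (excess s) ρ
        | allZero⇒dot≡0 (coefficients (excess s)) ρ zeros
  with constant (excess s) | nonNegative
... | + c | _ = +≤+ ℕ.z≤n

0≤slack : ∀ {n} (h : Fact n) ρ → ⟦ h ⟧ᶠ ρ → 0ℤ ≤ ⟦ slack h ⟧ ρ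
0≤slack (a :≤ b) ρ a≤b = ℤ.i≤j⇒0≤j-i a≤b
0≤slack (a :< b) ρ a<b =
  subst (0ℤ ≤_) (rearrange (⟦ a ⟧ ρ) (⟦ b ⟧ ρ)) (ℤ.i≤j⇒0≤j-i (ℤ.i<j⇒suc[i]≤j a<b))
  where
  rearrange : ∀ a b → b - (1ℤ + a) ≡ b - a - 1ℤ
  rearrange = solve-∀
0≤slack (a :≡ b) ρ a≡b = ℤ.i≤j⇒0≤j-i (ℤ.≤-reflexive a≡b)

0≤excess⇒ : ∀ {n} (s : Sequent n) ρ → 0ℤ ≤ ⟦ excess s ⟧ ρ → ⟦ s ⟧ˢ ρ
0≤excess⇒ (h ⇒ s) ρ 0≤e hyp = 0≤excess⇒ s ρ
  (subst (0ℤ ≤_) (cancel (⟦ excess s ⟧ ρ) (⟦ slack h ⟧ ρ))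
    (ℤ.+-mono-≤ 0≤e (0≤slack h ρ hyp)))
  where
  cancel : ∀ a b → a - b + b ≡ a
  cancel = solve-∀
0≤excess⇒ (∴≤ a b) ρ 0≤e = ℤ.0≤i-j⇒j≤i 0≤e
0≤excess⇒ (∴< a b) ρ 0≤e =
  ℤ.suc[i]≤j⇒i<j (ℤ.0≤i-j⇒j≤i (subst (0ℤ ≤_) (rearrange (⟦ a ⟧ ρ) (⟦ b ⟧ ρ)) 0≤e))
  where
  rearrange : ∀ a b → b - a - 1ℤ ≡ b - (1ℤ + a)
  rearrange = solve-∀
0≤excess⇒ ∴⊥ ρ ()

-- For a concrete `f` the hidden argument normalises to the unit type and is filled in
-- automatically. A subterm `+ suc x` of a goal is written `con 1ℤ :+ x`, since the two agree by
-- computation.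
lin : ∀ {n} (ρ : Vec ℤ n) (f : N-ary n (Expr n) (Sequent n)) →
      {T (Valid (f $ⁿ Vec.map var (Vec.allFin n)))} →
      ⟦ f $ⁿ Vec.map var (Vec.allFin n) ⟧ˢ ρ
lin {n} ρ f {v} = 0≤excess⇒ s ρ (valid⇒0≤excess s ρ v)
  where
  s : Sequent n
  s = f $ⁿ Vec.map var (Vec.allFin n)

offset : ∀ {a b} → a ≤ b → ∃[ k ] b ≡ a + + k
offset {a} {b} a≤b = ∣ b - a ∣ ,
  trans (rearrange a b) (cong (_+_ a) (sym (ℤ.0≤i⇒+∣i∣≡i (ℤ.i≤j⇒0≤j-i a≤b))))
  where
  rearrange : ∀ a b → b ≡ a + (b - a)
  rearrange = solve-∀

-- Columns

-- solid x has x + 1 cells; holed x y has x + 1 cells below the hole and y + 1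
-- cells above it.
data Shape : Set where
  solid : ℕ → Shape
  holed : ℕ → ℕ → Shape

extent below : Shape → ℕ
extent (solid x)   = x
extent (holed x y) = 2 ℕ.+ x ℕ.+ y
below (solid x)   = x
below (holed x y) = x

Within : ℤ × ℤ → ℤ → Set
Within (a , b) j = a ≤ j × j ≤ b

data IsRun (lo : ℤ) : Shape → ℤ × ℤ → Set where
  only  : ∀ {x} → IsRun lo (solid x) (lo , lo + + x)
  lower : ∀ {x y} → IsRun lo (holed x y) (lo , lo + + x)
  upper : ∀ {x y} →
          IsRun lo (holed x y) (lo + + (2 ℕ.+ x) , lo + + (2 ℕ.+ x) + + y)

InColumn : ℤ → Shape → ℤ → Set
InColumn lo K j = ∃[ r ] IsRun lo K r × Within r j

run : ℤ → ℤ → ℕ → List Cell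
run i lo x = applyUpTo (λ k → i , lo + + k) (suc x)

column : ℤ → ℤ → Shape → List Cell
column i lo (solid x)   = run i lo x
column i lo (holed x y) = run i lo x ++ run i (lo + + (2 ℕ.+ x)) y

∈-run⁺ : ∀ {i lo x j} → Within (lo , lo + + x) j → (i , j) ∈ run i lo x
∈-run⁺ {i} {lo} {x} (lo≤j , j≤hi) with offset lo≤j
... | k , refl = ∈-applyUpTo⁺ (λ k → i , lo + + k)
  (ℕ.s≤s (ℤ.drop‿+≤+ (lin (lo ∷ + k ∷ + x ∷ []) (λ lo k x →
    lo :+ k :≤ lo :+ x ⇒ ∴≤ k x) j≤hi)))

∈-run⁻ : ∀ lo x {i k j} → (k , j) ∈ run i lo x →
         k ≡ i × Within (lo , lo + + x) j
∈-run⁻ lo x {i} c∈ with ∈-applyUpTo⁻ (λ k → i , lo + + k) c∈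
... | k , ℕ.s≤s k≤x , refl = refl , ℤ.i≤i+j lo (+ k) , ℤ.+-monoʳ-≤ lo (+≤+ k≤x)

∈-column⁺ : ∀ {i lo K j} → InColumn lo K j → (i , j) ∈ column i lo K
∈-column⁺ (_ , only  , w) = ∈-run⁺ w
∈-column⁺ (_ , lower , w) = ∈-++⁺ˡ (∈-run⁺ w)
∈-column⁺ {i} {lo} {holed x _} (_ , upper , w) = ∈-++⁺ʳ (run i lo x) (∈-run⁺ w)

∈-column⁻ : ∀ lo K {i k j} → (k , j) ∈ column i lo K → k ≡ i × InColumn lo K j
∈-column⁻ lo (solid x) c∈ with ∈-run⁻ lo x c∈
... | k≡i , w = k≡i , _ , only , w
∈-column⁻ lo (holed x y) {i} c∈ with ∈-++⁻ (run i lo x) c∈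
... | inj₁ l with ∈-run⁻ lo x l
...   | k≡i , w = k≡i , _ , lower , w
∈-column⁻ lo (holed x y) {i} c∈ | inj₂ u with ∈-run⁻ (lo + + (2 ℕ.+ x)) y u
...   | k≡i , w = k≡i , _ , upper , w

-- Stated through membership, so that the order of the list is immaterial and the property
-- transports along set equality.
ColumnIs : List Cell → ℤ → ℤ → Shape → Set
ColumnIs cs i lo K = ∀ j → ((i , j) ∈ cs → InColumn lo K j) ×
                           (InColumn lo K j → (i , j) ∈ cs)

lowest : ∀ lo K → InColumn lo K lo
lowest lo (solid x)   = _ , only , ℤ.≤-refl , ℤ.i≤i+j lo (+ x)
lowest lo (holed x y) = _ , lower , ℤ.≤-refl , ℤ.i≤i+j lo (+ x)

0≤+ : ∀ n → 0ℤ ≤ + n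
0≤+ n = +≤+ ℕ.z≤n

-- Components

-- Component P is IsComponent (cells P), definitionally.
IsComponent : List Cell → ℤ → ℤ × ℤ → Set
IsComponent cs i (lo , hi) =
  lo ≤ hi ×
  (∀ j → lo ≤ j → j ≤ hi → (i , j) ∈ cs) ×
  (i , lo + -1ℤ) ∉ cs ×
  (i , hi + 1ℤ) ∉ cs

-- If `a < c`, the cell just below `c` still lies between `a` and `b`, because both intervals
-- contain `j`; but a component has no cell just below it.
bottom-≮ : ∀ {cs i a b c d j} → IsComponent cs i (a , b) → IsComponent cs i (c , d) →
           Within (a , b) j → Within (c , d) j → ¬ a < c
bottom-≮ {a = a} {b} {c} {d} {j} (_ , in₁ , _) (_ , _ , c∉ , _) (_ , j≤b) (c≤j , _) a<c =
  c∉ (in₁ _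
    (lin (a ∷ c ∷ []) (λ a c → a :< c ⇒ ∴≤ a (c :+ con -1ℤ)) a<c)
    (lin (c ∷ j ∷ b ∷ []) (λ c j b → c :≤ j ⇒ j :≤ b ⇒ ∴≤ (c :+ con -1ℤ) b) c≤j j≤b))

top-≮ : ∀ {cs i a b c d j} → IsComponent cs i (a , b) → IsComponent cs i (c , d) →
        Within (a , b) j → Within (c , d) j → ¬ b < d
top-≮ {a = a} {b} {c} {d} {j} (_ , _ , _ , b∉) (_ , in₂ , _) (_ , j≤b) (c≤j , _) b<d =
  b∉ (in₂ _
    (lin (c ∷ j ∷ b ∷ []) (λ c j b → c :≤ j ⇒ j :≤ b ⇒ ∴≤ c (b :+ con 1ℤ)) c≤j j≤b)
    (lin (b ∷ d ∷ []) (λ b d → b :< d ⇒ ∴≤ (b :+ con 1ℤ) d) b<d))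

component-unique : ∀ {cs i r r′ j} → IsComponent cs i r → IsComponent cs i r′ →
                   Within r j → Within r′ j → r ≡ r′
component-unique C C′ w w′ = cong₂ _,_
  (ℤ.≤-antisym (ℤ.≮⇒≥ (bottom-≮ C′ C w′ w)) (ℤ.≮⇒≥ (bottom-≮ C C′ w w′)))
  (ℤ.≤-antisym (ℤ.≮⇒≥ (top-≮ C′ C w′ w)) (ℤ.≮⇒≥ (top-≮ C C′ w w′)))

run-spans : ∀ {lo K j} → InColumn lo K j → Within (lo , lo + + extent K) j
run-spans (_ , only , w) = w
run-spans {lo} {holed x y} {j} (_ , lower , lo≤j , j≤hi) = lo≤j ,
  lin (lo ∷ + x ∷ + y ∷ j ∷ []) (λ lo x y j → j :≤ lo :+ x ⇒ con 0ℤ :≤ y ⇒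
    ∴≤ j (lo :+ (con (+ 2) :+ x :+ y))) j≤hi (0≤+ y)
run-spans {lo} {holed x y} {j} (_ , upper , lo≤j , j≤hi) =
  lin (lo ∷ + x ∷ j ∷ []) (λ lo x j → lo :+ (con (+ 2) :+ x) :≤ j ⇒ con 0ℤ :≤ x ⇒
    ∴≤ lo j) lo≤j (0≤+ x) ,
  lin (lo ∷ + x ∷ + y ∷ j ∷ []) (λ lo x y j → j :≤ lo :+ (con (+ 2) :+ x) :+ y ⇒
    ∴≤ j (lo :+ (con (+ 2) :+ x :+ y))) j≤hi

bottom∉ : ∀ lo K → ¬ InColumn lo K (lo + -1ℤ)
bottom∉ lo K c with run-spans c
... | lo≤ , _ = lin (lo ∷ []) (λ lo → lo :≤ lo :+ con -1ℤ ⇒ ∴⊥) lo≤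

top∉ : ∀ lo K → ¬ InColumn lo K (lo + + extent K + 1ℤ)
top∉ lo K c with run-spans c
... | _ , ≤hi = lin (lo + + extent K ∷ []) (λ hi → hi :+ con 1ℤ :≤ hi ⇒ ∴⊥) ≤hi

hole : ℤ → ℕ → ℤ
hole lo x = lo + + x + 1ℤ

hole∉ : ∀ lo x y → ¬ InColumn lo (holed x y) (hole lo x)
hole∉ lo x y (_ , lower , _ , ≤hi) =
  lin (lo ∷ + x ∷ []) (λ lo x → lo :+ x :+ con 1ℤ :≤ lo :+ x ⇒ ∴⊥) ≤hi
hole∉ lo x y (_ , upper , lo≤ , _) =
  lin (lo ∷ + x ∷ []) (λ lo x → lo :+ (con (+ 2) :+ x) :≤ lo :+ x :+ con 1ℤ ⇒ ∴⊥) lo≤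

run⇒component : ∀ {cs i lo K r} → ColumnIs cs i lo K → IsRun lo K r → IsComponent cs i r
run⇒component {lo = lo} {K} col (only {x}) =
  ℤ.i≤i+j lo (+ x) ,
  (λ j lo≤j j≤hi → proj₂ (col j) (_ , only , lo≤j , j≤hi)) ,
  bottom∉ lo K ∘ proj₁ (col _) , top∉ lo K ∘ proj₁ (col _)
run⇒component {lo = lo} {K} col (lower {x} {y}) =
  ℤ.i≤i+j lo (+ x) ,
  (λ j lo≤j j≤hi → proj₂ (col j) (_ , lower , lo≤j , j≤hi)) ,
  bottom∉ lo K ∘ proj₁ (col _) , hole∉ lo x y ∘ proj₁ (col _)
run⇒component {lo = lo} {K} col (upper {x} {y}) =
  ℤ.i≤i+j _ (+ y) ,
  (λ j lo≤j j≤hi → proj₂ (col j) (_ , upper , lo≤j , j≤hi)) ,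
  hole∉ lo x y ∘ subst (InColumn lo K) (below-upper lo (+ x)) ∘ proj₁ (col _) ,
  top∉ lo K ∘ subst (InColumn lo K) (above-upper lo (+ x) (+ y)) ∘ proj₁ (col _)
  where
  below-upper : ∀ lo x → lo + (+ 2 + x) + -1ℤ ≡ lo + x + 1ℤ
  below-upper = solve-∀
  above-upper : ∀ lo x y → lo + (+ 2 + x) + y + 1ℤ ≡ lo + (+ 2 + x + y) + 1ℤ
  above-upper = solve-∀

-- The lowest cell of the component lies in some run, and that run is itself a component, so the two
-- coincide by `component-unique`.
component⇒run : ∀ {cs i lo K r} → ColumnIs cs i lo K → IsComponent cs i r → IsRun lo K r
component⇒run {lo = lo} {K} {a , b} col C@(a≤b , in₁ , _)
  with proj₁ (col a) (in₁ a ℤ.≤-refl a≤b)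
... | r′ , R , w =
  subst (IsRun lo K) (component-unique (run⇒component col R) C w (ℤ.≤-refl , a≤b)) R

-- The cells (1ℤ + i , j) with an edge in common with column i form an
-- interval, even if column i has a hole.

Touches : List Cell → ℤ → ℤ → Set
Touches cs i j = (i , j) ∈ cs ⊎ (i , 1ℤ + j) ∈ cs

Reach : ℤ → ℕ → ℤ × ℤ
Reach lo s = (lo - 1ℤ , lo + + s)

touches⇒reach : ∀ {cs i lo K j} → ColumnIs cs i lo K → Touches cs i j →
                Within (Reach lo (extent K)) j
touches⇒reach {lo = lo} {K} {j} col (inj₁ j∈) with run-spans (proj₁ (col j) j∈)
... | lo≤j , j≤hi = lin (lo ∷ j ∷ []) (λ lo j → lo :≤ j ⇒ ∴≤ (lo :- con 1ℤ) j) lo≤j , j≤hi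
touches⇒reach {lo = lo} {K} {j} col (inj₂ j∈) with run-spans (proj₁ (col (1ℤ + j)) j∈)
... | lo≤j , j≤hi =
  lin (lo ∷ j ∷ []) (λ lo j → lo :≤ con 1ℤ :+ j ⇒ ∴≤ (lo :- con 1ℤ) j) lo≤j ,
  lin (lo + + extent K ∷ j ∷ []) (λ hi j → con 1ℤ :+ j :≤ hi ⇒ ∴≤ j hi) j≤hi

-- The upper left neighbour is needed at two heights only: at `lo - 1ℤ`, just below the column, and
-- at the height of the hole. Elsewhere the neighbour at the same height is present.
reach⇒touches : ∀ {cs i lo K j} → ColumnIs cs i lo K →
                Within (Reach lo (extent K)) j → Touches cs i j
reach⇒touches {lo = lo} {K} {j} col (lo-1≤j , j≤hi) with lo ℤ.≤? j
... | no lo≰j = inj₂ (proj₂ (col _) (subst (InColumn lo K) lo≡ (lowest lo K)))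
  where
  lo≡ : lo ≡ 1ℤ + j
  lo≡ = ℤ.≤-antisym
    (lin (lo ∷ j ∷ []) (λ lo j → lo :- con 1ℤ :≤ j ⇒ ∴≤ lo (con 1ℤ :+ j)) lo-1≤j)
    (lin (lo ∷ j ∷ []) (λ lo j → j :< lo ⇒ ∴≤ (con 1ℤ :+ j) lo) (ℤ.≰⇒> lo≰j))
reach⇒touches {K = solid x} col (_ , j≤hi) | yes lo≤j =
  inj₁ (proj₂ (col _) (_ , only , lo≤j , j≤hi))
reach⇒touches {lo = lo} {holed x y} {j} col (_ , j≤hi) | yes lo≤j with j ℤ.≤? lo + + x
... | yes j≤ = inj₁ (proj₂ (col _) (_ , lower , lo≤j , j≤))
... | no j≰ with lo + + (2 ℕ.+ x) ℤ.≤? j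
...   | yes ≤j = inj₁ (proj₂ (col _) (_ , upper , ≤j ,
  lin (lo ∷ + x ∷ + y ∷ j ∷ []) (λ lo x y j → j :≤ lo :+ (con (+ 2) :+ x :+ y) ⇒
    ∴≤ j (lo :+ (con (+ 2) :+ x) :+ y)) j≤hi))
-- Here `j` is the height of the hole, and `1ℤ + j` is the lowest cell of the upper part.
...   | no ≰j = inj₂ (proj₂ (col _) (_ , upper ,
  lin (lo ∷ + x ∷ j ∷ []) (λ lo x j → lo :+ x :< j ⇒
    ∴≤ (lo :+ (con (+ 2) :+ x)) (con 1ℤ :+ j)) (ℤ.≰⇒> j≰) ,
  lin (lo ∷ + x ∷ + y ∷ j ∷ []) (λ lo x y j → j :< lo :+ (con (+ 2) :+ x) ⇒ con 0ℤ :≤ y ⇒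
    ∴≤ (con 1ℤ :+ j) (lo :+ (con (+ 2) :+ x) :+ y)) (ℤ.≰⇒> ≰j) (0≤+ y)))

-- The admissible positions of a column of shape K next to one that spans
-- [lo , lo + s]: the hole, if any, is at lo + d, and otherwise the column ends
-- at lo + d - 1.
placements : ℕ → Shape → ℕ
placements s (solid x)   = 2 ℕ.+ s ℕ.+ x
placements s (holed x y) = s

start : ℤ → Shape → ℕ → ℤ
start lo K d = lo + + d - + suc (below K)

Meets : ℤ × ℤ → ℤ × ℤ → Set
Meets r r′ = ∃[ j ] Within r j × Within r′ j

meets : ∀ {a b c d} → a ≤ b → c ≤ d → a ≤ d → c ≤ b → Meets (a , b) (c , d)
meets {b = b} {d = d} a≤b c≤d a≤d c≤b with ℤ.≤-total b d
... | inj₁ b≤d = b , (a≤b , ℤ.≤-refl) , (c≤b , b≤d)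
... | inj₂ d≤b = d , (a≤d , d≤b) , (c≤d , ℤ.≤-refl)

reach-nonempty : ∀ lo s → lo - 1ℤ ≤ lo + + s
reach-nonempty lo s =
  lin (lo ∷ + s ∷ []) (λ lo s → con 0ℤ :≤ s ⇒ ∴≤ (lo :- con 1ℤ) (lo :+ s)) (0≤+ s)

placement⇒meets : ∀ lo s K (d : Fin (placements s K)) {r} →
                  IsRun (start lo K (toℕ d)) K r → Meets r (Reach lo s)
placement⇒meets lo s (solid x) d only = meets (ℤ.i≤i+j _ (+ x)) (reach-nonempty lo s)
  (lin (lo ∷ + s ∷ + x ∷ + toℕ d ∷ []) (λ lo s x d → con 1ℤ :+ d :≤ con (+ 2) :+ s :+ x ⇒
    ∴≤ (lo :+ d :- (con 1ℤ :+ x)) (lo :+ s)) (+≤+ (Fin.toℕ<n d)))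
  (lin (lo ∷ + s ∷ + x ∷ + toℕ d ∷ []) (λ lo s x d → con 0ℤ :≤ d ⇒
    ∴≤ (lo :- con 1ℤ) (lo :+ d :- (con 1ℤ :+ x) :+ x)) (0≤+ (toℕ d)))
placement⇒meets lo s (holed x y) d lower = meets (ℤ.i≤i+j _ (+ x)) (reach-nonempty lo s)
  (lin (lo ∷ + s ∷ + x ∷ + toℕ d ∷ []) (λ lo s x d → con 1ℤ :+ d :≤ s ⇒ con 0ℤ :≤ x ⇒
    ∴≤ (lo :+ d :- (con 1ℤ :+ x)) (lo :+ s)) (+≤+ (Fin.toℕ<n d)) (0≤+ x))
  (lin (lo ∷ + s ∷ + x ∷ + toℕ d ∷ []) (λ lo s x d → con 0ℤ :≤ d ⇒
    ∴≤ (lo :- con 1ℤ) (lo :+ d :- (con 1ℤ :+ x) :+ x)) (0≤+ (toℕ d)))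
placement⇒meets lo s (holed x y) d upper = meets (ℤ.i≤i+j _ (+ y)) (reach-nonempty lo s)
  (lin (lo ∷ + s ∷ + x ∷ + toℕ d ∷ []) (λ lo s x d → con 1ℤ :+ d :≤ s ⇒
    ∴≤ (lo :+ d :- (con 1ℤ :+ x) :+ (con (+ 2) :+ x)) (lo :+ s)) (+≤+ (Fin.toℕ<n d)))
  (lin (lo ∷ + y ∷ + x ∷ + toℕ d ∷ []) (λ lo y x d → con 0ℤ :≤ d ⇒ con 0ℤ :≤ y ⇒
    ∴≤ (lo :- con 1ℤ) (lo :+ d :- (con 1ℤ :+ x) :+ (con (+ 2) :+ x) :+ y)) (0≤+ (toℕ d)) (0≤+ y))

meets⇒bounds : ∀ {a b c d} → Meets (a , b) (c , d) → a ≤ d × c ≤ b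
meets⇒bounds (j , (a≤j , j≤b) , (c≤j , j≤d)) = ℤ.≤-trans a≤j j≤d , ℤ.≤-trans c≤j j≤b

start-surjective : ∀ lo lo′ K n →
  lo ≤ lo′ + + suc (below K) → lo′ + + suc (below K) < lo + + n →
  ∃[ d ] lo′ ≡ start lo K (toℕ {n} d)
start-surjective lo lo′ K n ≤base base<
  with offset ≤base
... | k , base≡ = Fin.fromℕ< k<n ,
  trans (rearrange lo′ (+ suc (below K)))
    (cong (λ z → z - + suc (below K))
      (trans base≡ (cong (λ k → lo + + k) (sym (Fin.toℕ-fromℕ< k<n)))))
  where
  rearrange : ∀ lo′ b → lo′ ≡ lo′ + b - b
  rearrange = solve-∀
  k<n : k ℕ.< n
  k<n = ℤ.drop‿+<+ (lin (lo ∷ + k ∷ + n ∷ lo′ + + suc (below K) ∷ []) (λ lo k n z →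
    z :< lo :+ n ⇒ lo :+ k :≡ z ⇒ ∴< k n) base< (sym base≡))

-- The quantity to confine is `lo′ + + suc (below K)`, the height just above the bottom run. With a
-- hole, the lower part must reach up to `lo - 1ℤ` and the upper part must start no higher than
-- `lo + + s`; these two conditions imply the other two, which is why `x` and `y` do not enter
-- `placements`.
meets⇒placement : ∀ lo s lo′ K → (∀ {r} → IsRun lo′ K r → Meets r (Reach lo s)) →
                  ∃[ d ] lo′ ≡ start lo K (toℕ {placements s K} d)
meets⇒placement lo s lo′ (solid x) m with meets⇒bounds (m only)
... | lo′≤ , ≤lo′ = start-surjective lo lo′ (solid x) (2 ℕ.+ s ℕ.+ x)
  (lin (lo ∷ lo′ ∷ + x ∷ []) (λ lo lo′ x → lo :- con 1ℤ :≤ lo′ :+ x ⇒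
    ∴≤ lo (lo′ :+ (con 1ℤ :+ x))) ≤lo′)
  (lin (lo ∷ lo′ ∷ + x ∷ + s ∷ []) (λ lo lo′ x s → lo′ :≤ lo :+ s ⇒
    ∴< (lo′ :+ (con 1ℤ :+ x)) (lo :+ (con (+ 2) :+ s :+ x))) lo′≤)
meets⇒placement lo s lo′ (holed x y) m with meets⇒bounds (m lower) | meets⇒bounds (m upper)
... | _ , ≤lo′ | up≤ , _ = start-surjective lo lo′ (holed x y) s
  (lin (lo ∷ lo′ ∷ + x ∷ []) (λ lo lo′ x → lo :- con 1ℤ :≤ lo′ :+ x ⇒
    ∴≤ lo (lo′ :+ (con 1ℤ :+ x))) ≤lo′)
  (lin (lo ∷ lo′ ∷ + x ∷ + s ∷ []) (λ lo lo′ x s → lo′ :+ (con (+ 2) :+ x) :≤ lo :+ s ⇒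
    ∴< (lo′ :+ (con 1ℤ :+ x)) (lo :+ s)) up≤)

start-injective : ∀ lo K {d d′} → start lo K d ≡ start lo K d′ → d ≡ d′
start-injective lo K {d} {d′} eq = ℤ.+-injective
  (ℤ.≤-antisym
    (lin (lo ∷ + d ∷ + d′ ∷ + suc (below K) ∷ []) (λ lo d d′ b →
      lo :+ d :- b :≡ lo :+ d′ :- b ⇒ ∴≤ d d′) eq)
    (lin (lo ∷ + d ∷ + d′ ∷ + suc (below K) ∷ []) (λ lo d d′ b →
      lo :+ d′ :- b :≡ lo :+ d :- b ⇒ ∴≤ d′ d) (sym eq)))

-- Codes

-- The columns to the right of one that spans an interval [lo , lo + s].
data Tail (s : ℕ) : Set where
  end  : Tail s
  next : ∀ K → Fin (placements s K) → Tail (extent K) → Tail s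

Code : Set
Code = Σ ℕ Tail

tailCells : ∀ {s} → ℤ → ℤ → Tail s → List Cell
tailCells i lo end = []
tailCells i lo (next K d t) =
  column (1ℤ + i) (start lo K (toℕ d)) K ++ tailCells (1ℤ + i) (start lo K (toℕ d)) t

codeCells : ℤ → ℤ → Code → List Cell
codeCells i lo (x , t) = run i lo x ++ tailCells i lo t

size : Shape → ℕ
size (solid x)   = suc x
size (holed x y) = suc x ℕ.+ suc y

tailArea : ∀ {s} → Tail s → ℕ
tailArea end          = 0
tailArea (next K _ t) = size K ℕ.+ tailArea t

codeArea : Code → ℕ
codeArea (x , t) = suc x ℕ.+ tailArea t

-- Only cells to the right of column `i` are constrained, so the recursion never refers back to
-- columns already read. The case `end` is what excludes further columns.
Fits : ∀ {s} → List Cell → ℤ → ℤ → Tail s → Set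
Fits cs i lo end = ∀ {k j} → i < k → (k , j) ∉ cs
Fits cs i lo (next K d t) =
  ColumnIs cs (1ℤ + i) (start lo K (toℕ d)) K ×
  Fits cs (1ℤ + i) (start lo K (toℕ d)) t

i<1+i : ∀ i → i < 1ℤ + i
i<1+i i = lin (i ∷ []) (λ i → ∴< i (con 1ℤ :+ i))

tail-right : ∀ {s} (t : Tail s) {i lo k j} → (k , j) ∈ tailCells i lo t → i < k
tail-right (next K d t) {i} {lo} c∈ with ∈-++⁻ (column (1ℤ + i) (start lo K (toℕ d)) K) c∈
... | inj₁ c∈col rewrite proj₁ (∈-column⁻ (start lo K (toℕ d)) K c∈col) = i<1+i i
... | inj₂ c∈t = ℤ.<-trans (i<1+i i) (tail-right t c∈t)

fits⁺ : ∀ {s} (t : Tail s) {cs i lo} →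
        (∀ {k j} → i < k → (k , j) ∈ cs → (k , j) ∈ tailCells i lo t) →
        (∀ {c} → c ∈ tailCells i lo t → c ∈ cs) → Fits cs i lo t
fits⁺ end to from i<k c∈ with () ← to i<k c∈
fits⁺ (next K d t) {cs} {i} {lo} to from =
  (λ j → (λ c∈ → case ∈-++⁻ (column (1ℤ + i) lo′ K) (to (i<1+i i) c∈) of λ where
            (inj₁ c∈col) → proj₂ (∈-column⁻ (start lo K (toℕ d)) K c∈col)
            (inj₂ c∈t) → contradiction (tail-right t c∈t) (ℤ.<-irrefl refl)) ,
         from ∘ ∈-++⁺ˡ ∘ ∈-column⁺) ,
  fits⁺ t
    (λ 1+i<k c∈ → case ∈-++⁻ (column (1ℤ + i) lo′ K) (to (ℤ.<-trans (i<1+i i) 1+i<k) c∈) of λ where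
      (inj₁ c∈col) → contradiction 1+i<k (ℤ.<-irrefl (sym (proj₁ (∈-column⁻ lo′ K c∈col))))
      (inj₂ c∈t) → c∈t)
    (from ∘ ∈-++⁺ʳ (column (1ℤ + i) lo′ K))
  where
  lo′ : ℤ
  lo′ = start lo K (toℕ d)

next-or-beyond : ∀ {i k} → i < k → k ≡ 1ℤ + i ⊎ 1ℤ + i < k
next-or-beyond {i} {k} i<k with k ℤ.≟ 1ℤ + i
... | yes k≡ = inj₁ k≡
... | no k≢ = inj₂ (ℤ.≤∧≢⇒< (ℤ.i<j⇒suc[i]≤j i<k) (k≢ ∘ sym))

fits⁻ : ∀ {s} (t : Tail s) {cs i lo k j} → Fits cs i lo t → i < k →
        (k , j) ∈ cs → (k , j) ∈ tailCells i lo t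
fits⁻ end fits i<k c∈ = contradiction c∈ (fits i<k)
fits⁻ (next K d t) {i = i} {lo} (col , fits) i<k c∈ with next-or-beyond i<k
... | inj₁ refl = ∈-++⁺ˡ (∈-column⁺ (proj₁ (col _) c∈))
... | inj₂ 1+i<k = ∈-++⁺ʳ (column (1ℤ + i) (start lo K (toℕ d)) K) (fits⁻ t fits 1+i<k c∈)

fits-⊆ : ∀ {s} (t : Tail s) {cs i lo c} → Fits cs i lo t → c ∈ tailCells i lo t → c ∈ cs
fits-⊆ (next K d t) {i = i} {lo} {c} (col , fits) c∈
  with ∈-++⁻ (column (1ℤ + i) (start lo K (toℕ d)) K) c∈
... | inj₂ c∈t = fits-⊆ t fits c∈t
... | inj₁ c∈col with ∈-column⁻ (start lo K (toℕ d)) K c∈col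
...   | refl , inCol = proj₂ (col _) inCol

-- The position `(i , lo)` of the lowest cell of the first column is kept apart from the code:
-- translating the cells changes the former and not the latter.
record Layout (cs : List Cell) (i lo : ℤ) (code : Code) : Set where
  field
    first : ColumnIs cs i lo (solid (proj₁ code))
    rest  : Fits cs i lo (proj₂ code)
    left  : ∀ {k j} → (k , j) ∈ cs → i ≤ k

layout⁺ : ∀ {cs i lo} code →
          (∀ {c} → c ∈ cs → c ∈ codeCells i lo code) →
          (∀ {c} → c ∈ codeCells i lo code → c ∈ cs) → Layout cs i lo code
layout⁺ {cs} {i} {lo} (x , t) to from = record
  { first = λ j →
      (λ c∈ → case ∈-++⁻ (run i lo x) (to c∈) of λ where
        (inj₁ c∈run) → _ , only , proj₂ (∈-run⁻ lo x c∈run)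
        (inj₂ c∈t) → contradiction (tail-right t c∈t) (ℤ.<-irrefl refl)) ,
      from ∘ ∈-++⁺ˡ ∘ ∈-column⁺ {K = solid x}
  ; rest = fits⁺ t
      (λ i<k c∈ → case ∈-++⁻ (run i lo x) (to c∈) of λ where
        (inj₁ c∈run) → contradiction i<k (ℤ.<-irrefl (sym (proj₁ (∈-run⁻ lo x c∈run))))
        (inj₂ c∈t) → c∈t)
      (from ∘ ∈-++⁺ʳ (run i lo x))
  ; left = λ c∈ → case ∈-++⁻ (run i lo x) (to c∈) of λ where
      (inj₁ c∈run) → ℤ.≤-reflexive (sym (proj₁ (∈-run⁻ lo x c∈run)))
      (inj₂ c∈t) → ℤ.<⇒≤ (tail-right t c∈t)
  }

module _ {cs i lo} code (L : Layout cs i lo code) where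
  open Layout L

  layout-⊇ : ∀ {c} → c ∈ cs → c ∈ codeCells i lo code
  layout-⊇ {k , j} c∈ with i ℤ.≟ k
  ... | yes refl = ∈-++⁺ˡ (∈-column⁺ {K = solid (proj₁ code)} (proj₁ (first j) c∈))
  ... | no i≢k = ∈-++⁺ʳ (run i lo (proj₁ code)) (fits⁻ (proj₂ code) rest (ℤ.≤∧≢⇒< (left c∈) i≢k) c∈)

  layout-⊆ : ∀ {c} → c ∈ codeCells i lo code → c ∈ cs
  layout-⊆ {c} c∈ with ∈-++⁻ (run i lo (proj₁ code)) c∈
  ... | inj₂ c∈t = fits-⊆ (proj₂ code) rest c∈t
  ... | inj₁ c∈run with ∈-run⁻ lo (proj₁ code) c∈run
  ...   | refl , w = proj₂ (first _) (_ , only , w)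

codeLayout : ∀ {i lo} code → Layout (codeCells i lo code) i lo code
codeLayout code = layout⁺ code (λ c∈ → c∈) (λ c∈ → c∈)

-- Distinctness and number of the cells of a code

run-unique : ∀ i lo x → Unique (run i lo x)
run-unique i lo x = Unique.applyUpTo⁺₁ (λ k → i , lo + + k) (suc x) λ {k} {l} k<l _ eq →
  lin (lo ∷ + k ∷ + l ∷ []) (λ lo k l → k :< l ⇒ lo :+ l :≡ lo :+ k ⇒ ∴⊥)
    (+<+ k<l) (sym (cong proj₂ eq))

column-unique : ∀ i lo K → Unique (column i lo K)
column-unique i lo (solid x) = run-unique i lo x
column-unique i lo (holed x y) =
  Unique.++⁺ (run-unique i lo x) (run-unique i (lo + + (2 ℕ.+ x)) y) λ {(_ , j)} (c∈l , c∈u) →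
    lin (lo ∷ + x ∷ j ∷ []) (λ lo x j → j :≤ lo :+ x ⇒ lo :+ (con (+ 2) :+ x) :≤ j ⇒ ∴⊥)
      (proj₂ (proj₂ (∈-run⁻ lo x c∈l))) (proj₁ (proj₂ (∈-run⁻ (lo + + (2 ℕ.+ x)) y c∈u)))

tail-unique : ∀ {s} i lo (t : Tail s) → Unique (tailCells i lo t)
tail-unique i lo end = []
tail-unique i lo (next K d t) =
  Unique.++⁺ (column-unique _ _ K) (tail-unique _ _ t) λ (c∈col , c∈t) →
    ℤ.<-irrefl (sym (proj₁ (∈-column⁻ (start lo K (toℕ d)) K c∈col))) (tail-right t c∈t)

code-unique : ∀ i lo code → Unique (codeCells i lo code)
code-unique i lo (x , t) =
  Unique.++⁺ (run-unique i lo x) (tail-unique i lo t) λ (c∈run , c∈t) →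
    ℤ.<-irrefl (sym (proj₁ (∈-run⁻ lo x c∈run))) (tail-right t c∈t)

length-column : ∀ i lo K → length (column i lo K) ≡ size K
length-column i lo (solid x) = length-applyUpTo (λ k → i , lo + + k) (suc x)
length-column i lo (holed x y) = trans (length-++ (run i lo x))
  (cong₂ ℕ._+_ (length-column i lo (solid x)) (length-column i (lo + + (2 ℕ.+ x)) (solid y)))

length-tailCells : ∀ {s} i lo (t : Tail s) → length (tailCells i lo t) ≡ tailArea t
length-tailCells i lo end = refl
length-tailCells i lo (next K d t) =
  trans (length-++ (column (1ℤ + i) (start lo K (toℕ d)) K))
        (cong₂ ℕ._+_ (length-column (1ℤ + i) (start lo K (toℕ d)) K)
          (length-tailCells (1ℤ + i) (start lo K (toℕ d)) t))

length-codeCells : ∀ i lo code → length (codeCells i lo code) ≡ codeArea code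
length-codeCells i lo (x , t) =
  trans (length-++ (run i lo x))
        (cong₂ ℕ._+_ (length-column i lo (solid x)) (length-tailCells i lo t))

-- Columns to the right of a given one

-- The local information from which both connectedness and semi-directedness follow. The left
-- neighbour is a field with an equation, so that matching on `successor` replaces `k` by
-- `1ℤ + before`.
record Attached (cs : List Cell) (k : ℤ) : Set where
  field
    {before}  : ℤ
    {lo}      : ℤ
    {K}       : Shape
    successor : k ≡ 1ℤ + before
    isColumn  : ColumnIs cs k lo K
    touching  : ∀ {r} → IsRun lo K r → ∃[ j ] Within r j × Touches cs before j

attached : ∀ K (t : Tail (extent K)) {cs i lo k j} → ColumnIs cs i lo K → Fits cs i lo t →
           i < k → (k , j) ∈ cs → Attached cs k
attached K end col fits i<k c∈ = contradiction c∈ (fits i<k)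
attached K (next K′ d t) {lo = lo} col (col′ , fits) i<k c∈ with next-or-beyond i<k
... | inj₂ 1+i<k = attached K′ t col′ fits 1+i<k c∈
... | inj₁ refl = record
  { successor = refl
  ; isColumn  = col′
  ; touching  = λ R → map₂ (map₂ (reach⇒touches col)) (placement⇒meets lo (extent K) K′ d R)
  }

-- Connectedness

directions-neg : ∀ {v} → v ∈ directions → (- proj₁ v , - proj₂ v) ∈ directions
directions-neg (here refl) = there (here refl)
directions-neg (there (here refl)) = here refl
directions-neg (there (there (here refl))) = there (there (there (there (here refl))))
directions-neg (there (there (there (here refl)))) = there (there (there (there (there (here refl)))))
directions-neg (there (there (there (there (here refl))))) = there (there (here refl))
directions-neg (there (there (there (there (there (here refl)))))) = there (there (there (here refl)))

adjacent-sym : ∀ {c d} → Adjacent c d → Adjacent d c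
adjacent-sym {c₁ , c₂} ((v₁ , v₂) , v∈ , refl) =
  _ , directions-neg v∈ , cong₂ _,_ (cancel v₁ c₁) (cancel v₂ c₂)
  where
  cancel : ∀ v c → c ≡ - v + (v + c)
  cancel = solve-∀

adjacent-left : ∀ i j → Adjacent (1ℤ + i , j) (i , j)
adjacent-left i j = _ , there (there (there (there (here refl)))) , cong₂ _,_ (left i) (stay j)
  where
  left : ∀ i → i ≡ -1ℤ + (1ℤ + i)
  left = solve-∀
  stay : ∀ j → j ≡ 0ℤ + j
  stay = solve-∀

adjacent-left-up : ∀ i j → Adjacent (1ℤ + i , j) (i , 1ℤ + j)
adjacent-left-up i j = _ , there (there (there (there (there (here refl))))) , cong₂ _,_ (left i) refl
  where
  left : ∀ i → i ≡ -1ℤ + (1ℤ + i)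
  left = solve-∀

touches⇒adjacent : ∀ {cs i j} → Touches cs i j →
                   ∃[ k ] (i , k) ∈ cs × Adjacent (1ℤ + i , j) (i , k)
touches⇒adjacent {i = i} {j} (inj₁ c∈) = j , c∈ , adjacent-left i j
touches⇒adjacent {i = i} {j} (inj₂ c∈) = 1ℤ + j , c∈ , adjacent-left-up i j

adjacent⇒touches : ∀ {cs i j k} → (i , k) ∈ cs → Adjacent (1ℤ + i , j) (i , k) → Touches cs i j
adjacent⇒touches {cs} {i} {j} {k} c∈ (_ , v∈ , eq) = cases v∈ (cong proj₁ eq) (cong proj₂ eq)
  where
  same-column : ¬ i ≡ 0ℤ + (1ℤ + i)
  same-column e = lin (i ∷ []) (λ i → con 0ℤ :+ (con 1ℤ :+ i) :≡ i ⇒ ∴⊥) (sym e)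
  right : ¬ i ≡ 1ℤ + (1ℤ + i)
  right e = lin (i ∷ []) (λ i → con 1ℤ :+ (con 1ℤ :+ i) :≡ i ⇒ ∴⊥) (sym e)
  cases : ∀ {v} → v ∈ directions → i ≡ proj₁ v + (1ℤ + i) → k ≡ proj₂ v + j → Touches cs i j
  cases (here refl) e _ = contradiction e same-column
  cases (there (here refl)) e _ = contradiction e same-column
  cases (there (there (here refl))) e _ = contradiction e right
  cases (there (there (there (here refl)))) e _ = contradiction e right
  cases (there (there (there (there (here refl))))) _ e =
    inj₁ (subst (λ k → (i , k) ∈ cs) (trans e (ℤ.+-identityˡ j)) c∈)
  cases (there (there (there (there (there (here refl)))))) _ e =
    inj₂ (subst (λ k → (i , k) ∈ cs) e c∈)

-- The relation in `Connected` requires only the target to be a cell, so its paths cannot be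
-- reversed step by step. Requiring both ends makes the relation symmetric, and `proj₂` recovers the
-- original one.
Step : List Cell → Cell → Cell → Set
Step cs c d = c ∈ cs × d ∈ cs × Adjacent c d

Path : List Cell → Cell → Cell → Set
Path cs = Star (Step cs)

path-sym : ∀ {cs c d} → Path cs c d → Path cs d c
path-sym = Star.reverse λ (c∈ , d∈ , adj) → d∈ , c∈ , adjacent-sym adj

path-up : ∀ {cs i a b} → (∀ j → a ≤ j → j ≤ b → (i , j) ∈ cs) →
          ∀ k → a + + k ≤ b → Path cs (i , a) (i , a + + k)
path-up {cs} {i} {a} in-cs zero _ =
  subst (λ z → Path cs (i , a) (i , z)) (sym (ℤ.+-identityʳ a)) ε
path-up {cs} {i} {a} {b} in-cs (suc k) ≤b =
  path-up in-cs k ≤b′ ◅◅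
  (in-cs _ (ℤ.i≤i+j a (+ k)) ≤b′ , in-cs _ (ℤ.i≤i+j a (+ suc k)) ≤b ,
   _ , here refl , cong₂ _,_ (sym (ℤ.+-identityˡ i)) (up a (+ k))) ◅ ε
  where
  ≤b′ : a + + k ≤ b
  ≤b′ = lin (a ∷ + k ∷ b ∷ []) (λ a k b → a :+ (con 1ℤ :+ k) :≤ b ⇒ ∴≤ (a :+ k) b) ≤b
  up : ∀ a k → a + (1ℤ + k) ≡ 1ℤ + (a + k)
  up = solve-∀

path-within : ∀ {cs i r j j′} → (∀ j → proj₁ r ≤ j → j ≤ proj₂ r → (i , j) ∈ cs) →
              Within r j → Within r j′ → Path cs (i , j) (i , j′)
path-within in-cs (a≤j , j≤b) (a≤j′ , j′≤b) with offset a≤j | offset a≤j′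
... | k , refl | k′ , refl = path-sym (path-up in-cs k j≤b) ◅◅ path-up in-cs k′ j′≤b

path-left : ∀ {cs k j} → Attached cs k → (k , j) ∈ cs →
            ∃₂ λ i′ j′ → k ≡ 1ℤ + i′ × (i′ , j′) ∈ cs × Path cs (k , j) (i′ , j′)
path-left record { successor = refl ; isColumn = col ; touching = touch } c∈
  with proj₁ (col _) c∈
... | r , R , w with touch R
...   | j* , w* , t with touches⇒adjacent t
...     | j′ , c′∈ , adj = _ , j′ , refl , c′∈ ,
  path-within in-cs w w* ◅◅ (in-cs j* (proj₁ w*) (proj₂ w*) , c′∈ , adj) ◅ ε
  where
  in-cs = proj₁ (proj₂ (run⇒component col R))

module _ {cs i lo} code (L : Layout cs i lo code) where
  open Layout L

  layout-attached : ∀ {k j} → i < k → (k , j) ∈ cs → Attached cs k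
  layout-attached = attached (solid (proj₁ code)) (proj₂ code) first rest

  -- Induction on the distance to the first column: a cell moves along its component to a cell
  -- touching the previous column and steps left. The first column is solid, so its lowest cell is
  -- reached vertically. Any two cells are joined through this corner.
  path-to-corner : ∀ n {k j} → k ≡ i + + n → (k , j) ∈ cs → Path cs (k , j) (i , lo)
  path-to-corner zero {j = j} k≡ c∈ with trans k≡ (ℤ.+-identityʳ i)
  ... | refl = path-within (λ j → λ ≤j j≤ → proj₂ (first j) (_ , only , ≤j , j≤)) w
                           (ℤ.≤-refl , ℤ.i≤i+j lo (+ proj₁ code))
    where
    w : Within (lo , lo + + proj₁ code) j
    w = run-spans (proj₁ (first j) c∈)
  path-to-corner (suc n) {k} k≡ c∈
    with path-left (layout-attached (lin (i ∷ + n ∷ k ∷ []) (λ i n k →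
           i :+ (con 1ℤ :+ n) :≡ k ⇒ con 0ℤ :≤ n ⇒ ∴< i k) (sym k≡) (0≤+ n)) c∈) c∈
  ... | i′ , j′ , refl , c′∈ , path = path ◅◅ path-to-corner n
    (ℤ.≤-antisym
      (lin (i ∷ + n ∷ i′ ∷ []) (λ i n i′ → con 1ℤ :+ i′ :≡ i :+ (con 1ℤ :+ n) ⇒
        ∴≤ i′ (i :+ n)) k≡)
      (lin (i ∷ + n ∷ i′ ∷ []) (λ i n i′ → i :+ (con 1ℤ :+ n) :≡ con 1ℤ :+ i′ ⇒
        ∴≤ (i :+ n) i′) (sym k≡)))
    c′∈

  layout-connected : Connected cs
  layout-connected c∈ d∈ = Star.map proj₂ (to-corner c∈ ◅◅ path-sym (to-corner d∈))
    where
    to-corner : ∀ {c} → c ∈ cs → Path cs c (i , lo)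
    to-corner {k , j} c∈ with offset (left c∈)
    ... | n , k≡ = path-to-corner n k≡ c∈

-- Cheesiness

module _ {a p} {A : Set a} {P : A → Set p} where

  -- The shape of a column is known only once the column has a cell. The bound is trivial for the
  -- empty list, so an element satisfying `P` may be assumed.
  atMost-inhabited : ∀ {n} → (∀ {x} → P x → AtMost n P) → AtMost n P
  atMost-inhabited h []       _ _        = ℕ.z≤n
  atMost-inhabited h (x ∷ xs) u (p ∷ ps) = h p (x ∷ xs) u (p ∷ ps)

  atMost-one : (∀ {x y} → P x → P y → x ≡ y) → AtMost 1 P
  atMost-one h []          _ _ = ℕ.z≤n
  atMost-one h (_ ∷ [])    _ _ = ℕ.s≤s ℕ.z≤n
  atMost-one h (_ ∷ _ ∷ _) ((x≢y ∷ _) ∷ _) (p ∷ q ∷ _) = contradiction (h p q) x≢y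

  atMost-two : ∀ {a b} → (∀ {x} → P x → x ≡ a ⊎ x ≡ b) → AtMost 2 P
  atMost-two h []       _ _ = ℕ.z≤n
  atMost-two h (_ ∷ []) _ _ = ℕ.s≤s ℕ.z≤n
  atMost-two h (_ ∷ _ ∷ []) _ _ = ℕ.s≤s (ℕ.s≤s ℕ.z≤n)
  atMost-two h (_ ∷ _ ∷ _ ∷ _) ((x≢y ∷ x≢z ∷ _) ∷ (y≢z ∷ _) ∷ _) (p ∷ q ∷ r ∷ _)
    with h p | h q | h r
  ... | inj₁ refl | inj₁ refl | _         = contradiction refl x≢y
  ... | inj₁ refl | inj₂ _    | inj₁ refl = contradiction refl x≢z
  ... | inj₁ _    | inj₂ refl | inj₂ refl = contradiction refl y≢z
  ... | inj₂ refl | inj₂ refl | _         = contradiction refl x≢y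
  ... | inj₂ refl | inj₁ _    | inj₂ refl = contradiction refl x≢z
  ... | inj₂ _    | inj₁ refl | inj₁ refl = contradiction refl y≢z

solid-run-unique : ∀ {lo x r r′} → IsRun lo (solid x) r → IsRun lo (solid x) r′ → r ≡ r′
solid-run-unique only only = refl

runs≤2 : ∀ lo K → AtMost 2 (IsRun lo K)
-- There is no second run; the annotation fills the second candidate of `atMost-two` with the same
-- run.
runs≤2 lo (solid x) = atMost-two λ where only → inj₁ {B = _ ≡ (lo , lo + + x)} refl
runs≤2 lo (holed x y) = atMost-two λ where
  lower → inj₁ refl
  upper → inj₂ refl

run-gap≤1 : ∀ {lo K lo₁ hi₁ lo₂ hi₂} → IsRun lo K (lo₁ , hi₁) → IsRun lo K (lo₂ , hi₂) →
            hi₁ < lo₂ → AtMost 1 (λ j → hi₁ < j × j < lo₂)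
run-gap≤1 {lo} only (only {x}) hi<lo = contradiction (ℤ.i≤i+j lo (+ x)) (ℤ.<⇒≱ hi<lo)
run-gap≤1 {lo} lower (lower {x}) hi<lo = contradiction (ℤ.i≤i+j lo (+ x)) (ℤ.<⇒≱ hi<lo)
run-gap≤1 {lo} upper (upper {x} {y}) hi<lo =
  contradiction (ℤ.i≤i+j (lo + + (2 ℕ.+ x)) (+ y)) (ℤ.<⇒≱ hi<lo)
run-gap≤1 {lo} upper (lower {x} {y}) hi<lo = ⊥-elim
  (lin (lo ∷ + x ∷ + y ∷ []) (λ lo x y → lo :+ (con (+ 2) :+ x) :+ y :< lo ⇒
    con 0ℤ :≤ x ⇒ con 0ℤ :≤ y ⇒ ∴⊥) hi<lo (0≤+ x) (0≤+ y))
run-gap≤1 {lo} lower (upper {x}) _ = atMost-one λ (<j , j<) (<j′ , j′<) →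
  ℤ.≤-antisym (squeeze <j′ j<) (squeeze <j j′<)
  where
  squeeze : ∀ {j j′} → lo + + x < j → j′ < lo + + (2 ℕ.+ x) → j′ ≤ j
  squeeze {j} {j′} = lin (lo ∷ + x ∷ j ∷ j′ ∷ []) λ lo x j j′ →
    lo :+ x :< j ⇒ j′ :< lo :+ (con (+ 2) :+ x) ⇒ ∴≤ j′ j

module _ (P : Polyomino) {i lo} code (L : Layout (cells P) i lo code) where
  open Layout L

  column-at : ∀ {k j} → (k , j) ∈ cells P → ∃₂ λ lo K → ColumnIs (cells P) k lo K
  column-at {k} c∈ with i ℤ.≟ k
  ... | yes refl = _ , _ , first
  ... | no i≢k = _ , _ , Attached.isColumn
    (layout-attached code L (ℤ.≤∧≢⇒< (left c∈) i≢k) c∈)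

  component-column : ∀ {k r} → Component P k r → ∃₂ λ lo K → ColumnIs (cells P) k lo K
  component-column {r = a , b} (a≤b , in₁ , _) = column-at (in₁ a ℤ.≤-refl a≤b)

  layout-firstColumn : ∀ k → FirstColumn P k → AtMost 1 (Component P k)
  layout-firstColumn k ((_ , c∈) , least)
    with refl ← ℤ.≤-antisym
      (least i (lo , proj₂ (first lo) (lowest lo (solid (proj₁ code))))) (left c∈) =
    atMost-one λ C C′ → solid-run-unique (component⇒run first C) (component⇒run first C′)

  layout-adjacentColumns : ∀ k k′ → AdjacentColumns P k k′ →
    ∀ lo hi → Component P k′ (lo , hi) →
    ∃₂ λ j l → lo ≤ j × j ≤ hi × (k , l) ∈ cells P × Adjacent (k′ , j) (k , l)
  layout-adjacentColumns k k′ ((_ , c∈) , (_ , c′∈) , k<k′ , none) lo hi C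
    with layout-attached code L (ℤ.≤-<-trans (left c∈) k<k′) c′∈
  ... | record { before = b ; successor = refl ; isColumn = col ; touching = touch }
    with touch (component⇒run col C)
  ... | j , (lo≤j , j≤hi) , t with touches⇒adjacent t
  ... | l , d∈ , adj with k ℤ.≟ b
  ... | yes refl = j , l , lo≤j , j≤hi , d∈ , adj
  -- Column `b` contains the touched cell, so it would lie strictly between the adjacent columns `k`
  -- and `k′`.
  ... | no k≢b = contradiction (l , d∈) (none b (ℤ.≤∧≢⇒< k≤b k≢b) (i<1+i b))
    where
    k≤b : k ≤ b
    k≤b = lin (k ∷ b ∷ []) (λ k b → k :< con 1ℤ :+ b ⇒ ∴≤ k b) k<k′

  layout-cheesy : Cheesy P 1
  layout-cheesy = record
    { semiDirected = layout-firstColumn , layout-adjacentColumns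
    ; components≤2 = λ k → atMost-inhabited λ C → let lo , K , col = component-column C in
        λ rs u Cs → runs≤2 lo K rs u (All.map (component⇒run col) Cs)
    ; gap≤m = λ k _ _ _ _ C C′ → let lo , K , col = component-column C in
        run-gap≤1 (component⇒run col C) (component⇒run col C′)
    }

polyomino : Code → Polyomino
polyomino code = record
  { cells     = codeCells 0ℤ 0ℤ code
  ; unique    = code-unique 0ℤ 0ℤ code
  ; nonEmpty  = λ ()
  ; connected = layout-connected code (codeLayout code)
  }

polyomino-cheesy : ∀ code → Cheesy (polyomino code) 1
polyomino-cheesy code = layout-cheesy (polyomino code) code (codeLayout code)


-- Decomposing a cheesy polyomino

least : ∀ {A : Set} {Q : A → Set} (f : A → ℤ) → Decidable Q → ∀ xs → Any Q xs →
        ∃[ x ] x ∈ xs × Q x × (∀ {y} → y ∈ xs → Q y → f x ≤ f y)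
least f Q? (x ∷ xs) some with Q? x | any? Q? xs
... | no ¬q | no ¬qs = contradiction some λ where
  (here q) → ¬q q
  (there qs) → ¬qs qs
... | no ¬q | yes qs with least f Q? xs qs
...   | m , m∈ , qm , min = m , there m∈ , qm , λ where
  (here refl) q → contradiction q ¬q
  (there y∈) q → min y∈ q
least f Q? (x ∷ xs) some | yes q | no ¬qs = x , here refl , q , λ where
  (here refl) _ → ℤ.≤-refl
  (there y∈) q → contradiction (lose y∈ q) ¬qs
least f Q? (x ∷ xs) some | yes q | yes qs with least f Q? xs qs
... | m , m∈ , qm , min with ℤ.≤-total (f x) (f m)
...   | inj₁ x≤m = x , here refl , q , λ where
  (here refl) _ → ℤ.≤-refl
  (there y∈) q → ℤ.≤-trans x≤m (min y∈ q)
...   | inj₂ m≤x = m , there m∈ , qm , λ where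
  (here refl) _ → m≤x
  (there y∈) q → min y∈ q

first-failure : ∀ {Q : ℕ → Set} → Decidable Q → ∀ n →
                (∀ k → k ℕ.≤ n → Q k) ⊎
                ∃[ k ] k ℕ.≤ n × ¬ Q k × (∀ l → l ℕ.< k → Q l)
first-failure Q? zero with Q? 0
... | yes q = inj₁ λ where zero ℕ.z≤n → q
... | no ¬q = inj₂ (0 , ℕ.z≤n , ¬q , λ _ ())
first-failure Q? (suc n) with first-failure Q? n
... | inj₂ (k , k≤n , ¬q , below) = inj₂ (k , ℕ.m≤n⇒m≤1+n k≤n , ¬q , below)
... | inj₁ all with Q? (suc n)
...   | no ¬q = inj₂ (suc n , ℕ.≤-refl , ¬q , λ l l<k → all l (ℕ.s≤s⁻¹ l<k))
...   | yes q = inj₁ λ k k≤ → case ℕ.m≤n⇒m<n∨m≡n k≤ of λ where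
  (inj₁ k<) → all k (ℕ.s≤s⁻¹ k<)
  (inj₂ refl) → q

module _ (P : Polyomino) where

  private
    cs : List Cell
    cs = cells P

  hasColumn? : Decidable (HasColumn P)
  hasColumn? i with any? (λ c → i ℤ.≟ proj₁ c) cs
  ... | yes a with find a
  ...   | (_ , j) , c∈ , refl = yes (j , c∈)
  hasColumn? i | no ¬a = no λ (j , c∈) → ¬a (lose c∈ refl)

  adjacent-≤ : ∀ {c d} → Adjacent c d → proj₁ d ≤ 1ℤ + proj₁ c
  adjacent-≤ {c , _} (v , v∈ , refl) = ℤ.+-monoˡ-≤ c (cases v∈)
    where
    cases : ∀ {v} → v ∈ directions → proj₁ v ≤ 1ℤ
    cases (here refl) = 0≤+ 1
    cases (there (here refl)) = 0≤+ 1
    cases (there (there (here refl))) = ℤ.≤-refl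
    cases (there (there (there (here refl)))) = ℤ.≤-refl
    cases (there (there (there (there (here refl))))) = -≤+
    cases (there (there (there (there (there (here refl)))))) = -≤+

  -- A discrete intermediate value argument: a step increases the column index by at most one, so a
  -- path cannot jump over `m`.
  path-columns : ∀ {c d m} → Star (λ x y → y ∈ cs × Adjacent x y) c d → c ∈ cs →
                 proj₁ c ≤ m → m ≤ proj₁ d → HasColumn P m
  path-columns {c} {d} {m} path c∈ c≤m m≤d with m ℤ.≟ proj₁ c
  ... | yes refl = proj₂ c , c∈
  path-columns ε c∈ c≤m m≤d | no m≢c = contradiction (ℤ.≤-antisym m≤d c≤m) m≢c
  path-columns ((e∈ , adj) ◅ path) c∈ c≤m m≤d | no m≢c =
    path-columns path e∈
      (ℤ.≤-trans (adjacent-≤ adj) (ℤ.i<j⇒suc[i]≤j (ℤ.≤∧≢⇒< c≤m (m≢c ∘ sym)))) m≤d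

  contiguous : ∀ {i k m} → HasColumn P i → HasColumn P k → i ≤ m → m ≤ k → HasColumn P m
  contiguous (_ , c∈) (_ , d∈) = path-columns (connected P c∈ d∈) c∈

  successive : ∀ {i} → HasColumn P i → HasColumn P (1ℤ + i) → AdjacentColumns P i (1ℤ + i)
  successive {i} h h′ = h , h′ , i<1+i i , λ k i<k k<1+i _ →
    lin (i ∷ k ∷ []) (λ i k → i :< k ⇒ k :< con 1ℤ :+ i ⇒ ∴⊥) i<k k<1+i

  module _ (C : Cheesy P 1) where
    open Cheesy C

    -- The lowest and the highest of the cells missing between min and max both lie
    -- between the lowest and the highest component, so by gap≤m they coincide.
    describe : ∀ {i} → HasColumn P i → ∃₂ λ lo K → ColumnIs cs i lo K
    describe {i} (_ , c∈)
      with least proj₂ (λ c → i ℤ.≟ proj₁ c) cs (lose c∈ refl)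
         | least (λ c → - proj₂ c) (λ c → i ℤ.≟ proj₁ c) cs (lose c∈ refl)
    ... | (_ , lo) , lo∈ , refl , min | (_ , hi) , hi∈ , refl , max = shape
      where
      lo≤ : ∀ {j} → (i , j) ∈ cs → lo ≤ j
      lo≤ j∈ = min j∈ refl

      ≤hi : ∀ {j} → (i , j) ∈ cs → j ≤ hi
      ≤hi j∈ = ℤ.neg-cancel-≤ (max j∈ refl)

      s : ℕ
      s = proj₁ (offset (lo≤ hi∈))

      hi≡ : hi ≡ lo + + s
      hi≡ = proj₂ (offset (lo≤ hi∈))

      cancel : ∀ a b → a + b - b ≡ a
      cancel = solve-∀

      shape : ∃₂ λ lo K → ColumnIs cs i lo K
      shape with first-failure (λ k → (i , lo + + k) ∈? cs) s
      ... | inj₁ all = lo , solid s , λ j →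
        (λ j∈ → _ , only , lo≤ j∈ , subst (_≤_ j) hi≡ (≤hi j∈)) ,
        λ where
          (_ , only , lo≤j , j≤hi) → case offset lo≤j of λ where
            (k , refl) → all k (ℤ.drop‿+≤+ (lin (lo ∷ + k ∷ + s ∷ []) (λ lo k s →
              lo :+ k :≤ lo :+ s ⇒ ∴≤ k s) j≤hi))
      ... | inj₂ (zero , _ , lo∉ , _) =
        contradiction (subst (λ z → (i , z) ∈ cs) (sym (ℤ.+-identityʳ lo)) lo∈) lo∉
      -- Offset 0 is `lo`, which is present, so the lowest missing offset is a successor and exactly
      -- `x + 1` cells lie below it. The search downwards from `hi` plays the same role for `y`.
      ... | inj₂ (suc x , x<s , p∉ , lower∈)
        with first-failure (λ k → (i , hi - + k) ∈? cs) s
      ...   | inj₂ (zero , _ , hi∉ , _) =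
        contradiction (subst (λ z → (i , z) ∈ cs) (sym (ℤ.+-identityʳ hi)) hi∈) hi∉
      ...   | inj₁ all = contradiction p∈ p∉
        where
        p≤hi : lo + + suc x ≤ hi
        p≤hi = subst (_≤_ _) (sym hi≡) (ℤ.+-monoʳ-≤ lo (+≤+ x<s))
        p∈ : (i , lo + + suc x) ∈ cs
        p∈ with offset p≤hi
        ... | k , hi≡p+k = subst (λ z → (i , z) ∈ cs)
          (trans (cong (λ z → z - + k) hi≡p+k) (cancel (lo + + suc x) (+ k)))
          (all k (ℤ.drop‿+≤+ (lin (lo ∷ hi ∷ + k ∷ + s ∷ + x ∷ []) (λ lo hi k s x →
            hi :≡ lo :+ s ⇒ lo :+ (con 1ℤ :+ x) :+ k :≡ hi ⇒ con 0ℤ :≤ x ⇒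
            ∴≤ k s) hi≡ (sym hi≡p+k) (0≤+ x))))
      ...   | inj₂ (suc y , y<s , r∉ , upper∈) = lo , holed x y , λ j →
        (λ j∈ → case j ℤ.≤? lo + + x of λ where
          (yes j≤) → _ , lower , lo≤ j∈ , j≤
          (no j≰) → _ , upper ,
            lin (lo ∷ + x ∷ j ∷ []) (λ lo x j → lo :+ (con 1ℤ :+ x) :< j ⇒
              ∴≤ (lo :+ (con (+ 2) :+ x)) j)
              (ℤ.≤∧≢⇒< (lin (lo ∷ + x ∷ j ∷ []) (λ lo x j → lo :+ x :< j ⇒
                ∴≤ (lo :+ (con 1ℤ :+ x)) j) (ℤ.≰⇒> j≰)) (λ where refl → p∉ j∈)) ,
            subst (_≤_ j) hi≡top (≤hi j∈)) ,
        λ where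
          (_ , lower , lo≤j , j≤) → in-lower j lo≤j j≤
          (_ , upper , ≤j , j≤) → in-upper j
            (lin (lo ∷ + x ∷ + y ∷ hi ∷ j ∷ []) (λ lo x y hi j →
              lo :+ (con (+ 2) :+ x) :≤ j ⇒ hi :≡ lo :+ (con (+ 2) :+ x) :+ y ⇒
              ∴≤ (hi :- y) j) ≤j hi≡top)
            (subst (_≤_ j) (sym hi≡top) j≤)
        where
        p r : ℤ
        p = lo + + suc x
        r = hi - + suc y

        in-lower : ∀ j → lo ≤ j → j ≤ lo + + x → (i , j) ∈ cs
        in-lower j lo≤j j≤ with offset lo≤j
        ... | k , refl = lower∈ k (ℕ.s≤s (ℤ.drop‿+≤+ (lin (lo ∷ + k ∷ + x ∷ []) (λ lo k x →
          lo :+ k :≤ lo :+ x ⇒ ∴≤ k x) j≤)))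

        in-upper : ∀ j → hi - + y ≤ j → j ≤ hi → (i , j) ∈ cs
        in-upper j ≤j j≤hi with offset j≤hi
        ... | k , hi≡j+k = subst (λ z → (i , z) ∈ cs)
          (trans (cong (λ z → z - + k) hi≡j+k) (cancel j (+ k)))
          (upper∈ k (ℕ.s≤s (ℤ.drop‿+≤+ (lin (hi ∷ j ∷ + k ∷ + y ∷ []) (λ hi j k y →
            hi :- y :≤ j ⇒ j :+ k :≡ hi ⇒ ∴≤ k y) ≤j (sym hi≡j+k)))))

        lowerComponent : Component P i (lo , lo + + x)
        lowerComponent = ℤ.i≤i+j lo (+ x) , in-lower ,
          (λ c → lin (lo ∷ []) (λ lo → lo :≤ lo :+ con -1ℤ ⇒ ∴⊥) (lo≤ c)) ,
          p∉ ∘ subst (λ z → (i , z) ∈ cs) (p≡ lo (+ x))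
          where
          p≡ : ∀ lo x → lo + x + 1ℤ ≡ lo + (1ℤ + x)
          p≡ = solve-∀

        upperComponent : Component P i (hi - + y , hi)
        upperComponent = ℤ.i-j≤i hi (+ y) , in-upper ,
          r∉ ∘ subst (λ z → (i , z) ∈ cs) (r≡ hi (+ y)) ,
          (λ c → lin (hi ∷ []) (λ hi → hi :+ con 1ℤ :≤ hi ⇒ ∴⊥) (≤hi c))
          where
          r≡ : ∀ hi y → hi - y + -1ℤ ≡ hi - (1ℤ + y)
          r≡ = solve-∀

        -- `p` is missing and at most `hi`, whereas all heights from `hi - + y` to `hi` are present.
        p<upper : p < hi - + y
        p<upper = ℤ.≰⇒> λ ≤p → p∉ (in-upper p ≤p
          (subst (_≤_ p) (sym hi≡) (ℤ.+-monoʳ-≤ lo (+≤+ x<s))))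

        p≡r : p ≡ r
        p≡r with p ℤ.≟ r
        ... | yes eq = eq
        ... | no p≢r = contradiction
          (gap≤m i _ _ _ _ lowerComponent upperComponent lower<upper (p ∷ r ∷ [])
            ((p≢r ∷ []) ∷ [] ∷ []) ((lower<p , p<upper) ∷ (lower<r , r<upper) ∷ []))
          λ where (ℕ.s≤s ())
          where
          lower<p : lo + + x < p
          lower<p = lin (lo ∷ + x ∷ []) (λ lo x → ∴< (lo :+ x) (lo :+ (con 1ℤ :+ x)))
          lower<upper : lo + + x < hi - + y
          lower<upper = ℤ.<-trans lower<p p<upper
          lower<r : lo + + x < r
          lower<r = lin (lo ∷ + x ∷ hi ∷ + y ∷ []) (λ lo x hi y →
            lo :+ (con 1ℤ :+ x) :< hi :- y ⇒ ∴< (lo :+ x) (hi :- (con 1ℤ :+ y))) p<upper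
          r<upper : r < hi - + y
          r<upper = lin (hi ∷ + y ∷ []) (λ hi y → ∴< (hi :- (con 1ℤ :+ y)) (hi :- y))

        hi≡top : hi ≡ lo + + (2 ℕ.+ x) + + y
        hi≡top = trans (rearrange hi (+ y))
          (trans (cong (λ z → z + (1ℤ + + y)) (sym p≡r)) (rearrange′ lo (+ x) (+ y)))
          where
          rearrange : ∀ hi y → hi ≡ hi - (1ℤ + y) + (1ℤ + y)
          rearrange = solve-∀
          rearrange′ : ∀ lo x y → lo + (1ℤ + x) + (1ℤ + y) ≡ lo + (+ 2 + x) + y
          rearrange′ = solve-∀

    meets-left : ∀ {i lo lo′ K K′} → ColumnIs cs i lo K → ColumnIs cs (1ℤ + i) lo′ K′ →
                 ∀ {r} → IsRun lo′ K′ r → Meets r (Reach lo (extent K))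
    meets-left col col′ R
      with proj₂ semiDirected _ _
             (successive (_ , proj₂ (col _) (lowest _ _)) (_ , proj₂ (col′ _) (lowest _ _)))
             _ _ (run⇒component col′ R)
    ... | j , k , lo≤j , j≤hi , c∈ , adj =
      j , (lo≤j , j≤hi) , touches⇒reach col (adjacent⇒touches c∈ adj)

    -- `n` bounds the number of columns still to be read and makes the recursion structural. If
    -- column `1ℤ + i` is empty, `contiguous` shows that nothing lies beyond it.
    tail-of : ∀ n {i lo} K → ColumnIs cs i lo K → (∀ {k j} → (k , j) ∈ cs → k ≤ i + + n) →
              ∃[ t ] Fits {extent K} cs i lo t
    tail-of zero {i} K col bounded = end , λ i<k c∈ →
      ℤ.<⇒≱ i<k (subst (_≤_ _) (ℤ.+-identityʳ i) (bounded c∈))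
    tail-of (suc n) {i} {lo} K col bounded with hasColumn? (1ℤ + i)
    ... | no empty = end , λ i<k c∈ →
      empty (contiguous (_ , proj₂ (col lo) (lowest lo K)) (_ , c∈)
        (ℤ.<⇒≤ (i<1+i i)) (ℤ.i<j⇒suc[i]≤j i<k))
    ... | yes h with describe h
    ...   | lo′ , K′ , col′ with meets⇒placement lo (extent K) lo′ K′ (meets-left col col′)
    ...     | d , refl with tail-of n K′ col′ (λ c∈ → subst (_≤_ _) (shift i (+ n)) (bounded c∈))
      where
      shift : ∀ i n → i + (1ℤ + n) ≡ 1ℤ + i + n
      shift = solve-∀
    ...       | t , fits = next K′ d t , col′ , fits

    layout : ∃[ f ] ∃[ lo ] ∃[ code ] Layout cs f lo code
    layout
      with least proj₁ (λ _ → yes tt) cs nonempty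
         | least (λ c → - proj₁ c) (λ _ → yes tt) cs nonempty
      where
      some : ∀ {xs : List Cell} → xs ≢ [] → Any (λ _ → ⊤) xs
      some {[]} []≢[] = contradiction refl []≢[]
      some {_ ∷ _} _ = here tt
      nonempty : Any (λ _ → ⊤) cs
      nonempty = some (nonEmpty P)
    ... | (f , j) , f∈ , _ , min | (l , _) , l∈ , _ , max with describe (j , f∈) | offset (min l∈ tt)
    -- A hole in the leftmost column would give it two distinct components.
    ...   | lo , holed x y , col | _ = contradiction
      (proj₁ semiDirected f ((j , f∈) , λ k (_ , c∈) → min c∈ tt)
        ((lo , lo + + x) ∷ (lo + + (2 ℕ.+ x) , lo + + (2 ℕ.+ x) + + y) ∷ [])
        ((distinct ∷ []) ∷ [] ∷ [])
        (run⇒component col lower ∷ run⇒component col upper ∷ []))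
      λ where (ℕ.s≤s ())
      where
      distinct : (lo , lo + + x) ≢ (lo + + (2 ℕ.+ x) , lo + + (2 ℕ.+ x) + + y)
      distinct eq = lin (lo ∷ + x ∷ []) (λ lo x → lo :+ (con (+ 2) :+ x) :≡ lo ⇒ con 0ℤ :≤ x ⇒ ∴⊥)
        (sym (cong proj₁ eq)) (0≤+ x)
    ...   | lo , solid x , col | n , refl
      with tail-of n (solid x) col (λ c∈ → ℤ.neg-cancel-≤ (max c∈ tt))
    ...     | t , fits = f , lo , (x , t) ,
      record { first = col ; rest = fits ; left = λ c∈ → min c∈ tt }


-- Translations

applyUpTo-cong : ∀ {A : Set} {f g : ℕ → A} → f ≗ g → ∀ n → applyUpTo f n ≡ applyUpTo g n
applyUpTo-cong f≗g zero    = refl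
applyUpTo-cong f≗g (suc n) = cong₂ _∷_ (f≗g 0) (applyUpTo-cong (f≗g ∘ suc) n)

map-run : ∀ a b i lo x → map ((a , b) ⊕_) (run i lo x) ≡ run (a + i) (b + lo) x
map-run a b i lo x = trans (map-applyUpTo (λ k → i , lo + + k) ((a , b) ⊕_) (suc x))
  (applyUpTo-cong (λ k → cong (_,_ (a + i)) (sym (ℤ.+-assoc b lo (+ k)))) (suc x))

map-column : ∀ a b i lo K → map ((a , b) ⊕_) (column i lo K) ≡ column (a + i) (b + lo) K
map-column a b i lo (solid x) = map-run a b i lo x
map-column a b i lo (holed x y) = trans (map-++ _ (run i lo x) _)
  (cong₂ _++_ (map-run a b i lo x)
    (trans (map-run a b i _ y)
      (cong (λ z → run (a + i) z y) (sym (ℤ.+-assoc b lo (+ (2 ℕ.+ x)))))))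

map-tailCells : ∀ {s} a b i lo (t : Tail s) →
                map ((a , b) ⊕_) (tailCells i lo t) ≡ tailCells (a + i) (b + lo) t
map-tailCells a b i lo end = refl
map-tailCells a b i lo (next K d t) =
  trans (map-++ _ (column (1ℤ + i) lo′ K) _)
    (trans (cong₂ _++_ (map-column a b (1ℤ + i) lo′ K) (map-tailCells a b (1ℤ + i) lo′ t))
      (cong₂ (λ i lo → column i lo K ++ tailCells i lo t)
        (right a i) (up b lo (+ toℕ d) (+ suc (below K)))))
  where
  lo′ : ℤ
  lo′ = start lo K (toℕ d)
  right : ∀ a i → a + (1ℤ + i) ≡ 1ℤ + (a + i)
  right = solve-∀
  up : ∀ b lo d k → b + (lo + d - k) ≡ b + lo + d - k
  up = solve-∀

map-codeCells : ∀ a b i lo code →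
                map ((a , b) ⊕_) (codeCells i lo code) ≡ codeCells (a + i) (b + lo) code
map-codeCells a b i lo (x , t) = trans (map-++ _ (run i lo x) _)
  (cong₂ _++_ (map-run a b i lo x) (map-tailCells a b i lo t))

layout⇒≈ : ∀ (P : Polyomino) {i lo} code → Layout (cells P) i lo code → polyomino code ≈ P
layout⇒≈ P {i} {lo} code L = (i , lo) ,
  subst (_∼[ set ] cells P) (sym translated)
    (mk⇔ (layout-⊆ code L) (layout-⊇ code L))
  where
  translated : map ((i , lo) ⊕_) (codeCells 0ℤ 0ℤ code) ≡ codeCells i lo code
  translated = trans (map-codeCells i lo 0ℤ 0ℤ code)
    (cong₂ (λ i lo → codeCells i lo code) (ℤ.+-identityʳ i) (ℤ.+-identityʳ lo))

≈⇒layout : ∀ code (P : Polyomino) → polyomino code ≈ P →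
           ∃₂ λ i lo → Layout (cells P) i lo code
≈⇒layout code P ((i , lo) , eq) = i + 0ℤ , lo + 0ℤ ,
  layout⁺ code (Equivalence.to eq′) (Equivalence.from eq′)
  where
  eq′ : ∀ {c} → c ∈ cells P ⇔ c ∈ codeCells (i + 0ℤ) (lo + 0ℤ) code
  eq′ {c} = subst (λ cs → c ∈ cells P ⇔ c ∈ cs) (map-codeCells i lo 0ℤ 0ℤ code)
    (mk⇔ (Equivalence.from eq) (Equivalence.to eq))

⊕-injective : ∀ t {c d} → t ⊕ c ≡ t ⊕ d → c ≡ d
⊕-injective (a , b) {c₁ , c₂} {d₁ , d₂} eq =
  cong₂ _,_ (∙-cancelˡ a c₁ d₁ (cong proj₁ eq)) (∙-cancelˡ b c₂ d₂ (cong proj₂ eq))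

-- Set equality forgets multiplicities. Neither list repeats a cell, and translation is injective,
-- so the lists are equal as bags and hence permutations of each other.
≈⇒area≡ : ∀ (P Q : Polyomino) → P ≈ Q → area P ≡ area Q
≈⇒area≡ P Q (t , eq) = trans (sym (length-map (t ⊕_) (cells P)))
  (↭-length (∼bag⇒↭ (unique∧set⇒bag (Unique.map⁺ (⊕-injective t) (unique P)) (unique Q) eq)))

-- Uniqueness of codes

highest : ∀ lo K → InColumn lo K (lo + + extent K)
highest lo (solid x) = _ , only , ℤ.i≤i+j lo (+ x) , ℤ.≤-refl
highest lo (holed x y) = _ , upper ,
  lin (lo ∷ + x ∷ + y ∷ []) (λ lo x y → con 0ℤ :≤ y ⇒
    ∴≤ (lo :+ (con (+ 2) :+ x)) (lo :+ (con (+ 2) :+ x :+ y))) (0≤+ y) ,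
  lin (lo ∷ + x ∷ + y ∷ []) (λ lo x y →
    ∴≤ (lo :+ (con (+ 2) :+ x :+ y)) (lo :+ (con (+ 2) :+ x) :+ y))

ColumnWithin : ℤ → Shape → ℤ → Shape → Set
ColumnWithin lo K lo′ K′ = ∀ j → InColumn lo K j → InColumn lo′ K′ j

column-spans : ∀ {lo K lo′ K′} → ColumnWithin lo K lo′ K′ →
               lo′ ≤ lo × lo + + extent K ≤ lo′ + + extent K′
column-spans {lo} {K} same =
  proj₁ (run-spans (same _ (lowest lo K))) , proj₂ (run-spans (same _ (highest lo K)))

-- If `x′ < x`, the hole of the larger column would be a cell of the lower part of the smaller one.
hole-≤ : ∀ {lo x y x′ y′} → ColumnWithin lo (holed x y) lo (holed x′ y′) → x ℕ.≤ x′
hole-≤ {lo} {x} {y} {x′} {y′} same = ℕ.≮⇒≥ λ x′<x → hole∉ lo x′ y′ (same _ (_ , lower ,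
  lin (lo ∷ + x′ ∷ []) (λ lo x → con 0ℤ :≤ x ⇒ ∴≤ lo (lo :+ x :+ con 1ℤ)) (0≤+ x′) ,
  lin (lo ∷ + x ∷ + x′ ∷ []) (λ lo x x′ → x′ :< x ⇒
    ∴≤ (lo :+ x′ :+ con 1ℤ) (lo :+ x)) (+<+ x′<x)))

solid-⊈-holed : ∀ {lo} x y → ¬ ColumnWithin lo (solid (extent (holed x y))) lo (holed x y)
solid-⊈-holed {lo} x y same = hole∉ lo x y (same _ (_ , only ,
  lin (lo ∷ + x ∷ []) (λ lo x → con 0ℤ :≤ x ⇒ ∴≤ lo (lo :+ x :+ con 1ℤ)) (0≤+ x) ,
  lin (lo ∷ + x ∷ + y ∷ []) (λ lo x y → con 0ℤ :≤ y ⇒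
    ∴≤ (lo :+ x :+ con 1ℤ) (lo :+ (con (+ 2) :+ x :+ y))) (0≤+ y)))

shape-injective : ∀ {lo} K K′ → ColumnWithin lo K lo K′ → ColumnWithin lo K′ lo K →
                  extent K ≡ extent K′ → K ≡ K′
shape-injective (solid x) (solid x′) _ _ refl = refl
shape-injective (solid _) (holed x y) same _ refl = contradiction same (solid-⊈-holed x y)
shape-injective (holed x y) (solid _) _ same refl = contradiction same (solid-⊈-holed x y)
shape-injective {lo} (holed x y) (holed x′ y′) same same′ eq
  with refl ← ℕ.≤-antisym (hole-≤ {lo} {x} {y} same) (hole-≤ {lo} {x′} {y′} same′) =
  cong (holed x) (ℕ.+-cancelˡ-≡ x y y′ (ℕ.suc-injective (ℕ.suc-injective eq)))

column-injective : ∀ {cs i lo K lo′ K′} → ColumnIs cs i lo K → ColumnIs cs i lo′ K′ →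
                   lo ≡ lo′ × K ≡ K′
column-injective {lo = lo} {K} {lo′} {K′} col col′
  with same ← (λ j → proj₁ (col′ j) ∘ proj₂ (col j))
     | same′ ← (λ j → proj₁ (col j) ∘ proj₂ (col′ j))
  with lo′≤lo , top≤ ← column-spans {lo} {K} {lo′} {K′} same
     | lo≤lo′ , ≤top ← column-spans {lo′} {K′} {lo} {K} same′
  with refl ← ℤ.≤-antisym lo≤lo′ lo′≤lo =
  refl , shape-injective K K′ same same′ (ℕ.≤-antisym (cancel top≤) (cancel ≤top))
  where
  cancel : ∀ {m n} → lo + + m ≤ lo + + n → m ℕ.≤ n
  cancel {m} {n} le = ℤ.drop‿+≤+ (lin (lo ∷ + m ∷ + n ∷ []) (λ lo m n →
    lo :+ m :≤ lo :+ n ⇒ ∴≤ m n) le)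

fits-injective : ∀ {s} (t t′ : Tail s) {cs i lo} → Fits cs i lo t → Fits cs i lo t′ → t ≡ t′
fits-injective end end _ _ = refl
fits-injective end (next K d t) {i = i} fits (col , _) =
  contradiction (proj₂ (col _) (lowest _ K)) (fits (i<1+i i))
fits-injective (next K d t) end {i = i} (col , _) fits =
  contradiction (proj₂ (col _) (lowest _ K)) (fits (i<1+i i))
fits-injective (next K d t) (next K′ d′ t′) {lo = lo} (col , fits) (col′ , fits′)
  with column-injective col col′
... | lo≡ , refl with refl ← Fin.toℕ-injective (start-injective lo K lo≡) =
  cong (next K d) (fits-injective t t′ fits fits′)

-- Each layout contains a cell in its own first column and has none further left, so the two first
-- columns have the same index. Columns are compared from there to the right, each fixing the
-- position and shape of the next.
layout-injective : ∀ {cs i lo i′ lo′} code code′ →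
                   Layout cs i lo code → Layout cs i′ lo′ code′ → code ≡ code′
layout-injective {lo = lo} {lo′ = lo′} (x , t) (x′ , t′) L L′
  with refl ← ℤ.≤-antisym (Layout.left L (proj₂ (Layout.first L′ _) (lowest lo′ (solid x′))))
                          (Layout.left L′ (proj₂ (Layout.first L _) (lowest lo (solid x))))
  with refl , refl ← column-injective (Layout.first L) (Layout.first L′) =
  cong (x ,_) (fits-injective t t′ (Layout.rest L) (Layout.rest L′))

polyomino-injective : ∀ code code′ → polyomino code ≈ polyomino code′ → code ≡ code′
polyomino-injective code code′ eq =
  layout-injective code code′ (proj₂ (proj₂ (≈⇒layout code (polyomino code′) eq)))
    (codeLayout code′)

polyomino-surjective : ∀ P → Cheesy P 1 → ∃[ code ] polyomino code ≈ P
polyomino-surjective P C with layout P C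
... | _ , _ , code , L = code , layout⇒≈ P code L


-- Enumeration of codes

record Listing {A : Set} (Q : A → Set) : Set where
  field
    list     : List A
    distinct : Unique list
    sound    : ∀ {x} → x ∈ list → Q x
    complete : ∀ {x} → Q x → x ∈ list

  count : ℕ
  count = length list

open Listing using (count)

listing-⇔ : ∀ {A : Set} {Q R : A → Set} → (∀ {x} → Q x → R x) → (∀ {x} → R x → Q x) →
            Listing Q → Listing R
listing-⇔ to from L = record
  { list = list ; distinct = distinct ; sound = to ∘ sound ; complete = complete ∘ from }
  where open Listing L

listing-∅ : ∀ {A : Set} {Q : A → Set} → (∀ {x} → ¬ Q x) → Listing Q
listing-∅ empty = record
  { list = [] ; distinct = [] ; sound = λ () ; complete = λ q → contradiction q empty }

listing-⊎ : ∀ {A : Set} {Q R : A → Set} → (∀ {x} → Q x → ¬ R x) →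
            Listing Q → Listing R → Listing (λ x → Q x ⊎ R x)
listing-⊎ disjoint L M = record
  { list     = L.list ++ M.list
  ; distinct = Unique.++⁺ L.distinct M.distinct λ (x∈L , x∈M) →
                 disjoint (L.sound x∈L) (M.sound x∈M)
  ; sound    = Sum.map L.sound M.sound ∘ ∈-++⁻ L.list
  ; complete = [ ∈-++⁺ˡ ∘ L.complete , ∈-++⁺ʳ L.list ∘ M.complete ]′
  }
  where
  module L = Listing L
  module M = Listing M

-- The elements of R n′ x′, where (n′ , x′) arises from (n , x) by moving units
-- from n to x.
Grow : {A : Set} → (ℕ → ℕ → A → Set) → ℕ → ℕ → A → Set
Grow R n x a = ∃₂ λ n′ x′ → x ℕ.≤ x′ × n′ ℕ.+ x′ ≡ n ℕ.+ x × R n′ x′ a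

module _ {A : Set} {R : ℕ → ℕ → A → Set} where

  grow-zero : ∀ {x} → Listing (R 0 x) → Listing (Grow R 0 x)
  grow-zero {x} = listing-⇔ (λ r → 0 , x , ℕ.≤-refl , refl , r) λ
    (n′ , x′ , x≤x′ , eq , r) → case (x′≡x n′ x≤x′ eq) of λ where
      refl → subst (λ n → R n x _) (ℕ.+-cancelʳ-≡ x n′ 0 eq) r
    where
    x′≡x : ∀ n′ {x′} → x ℕ.≤ x′ → n′ ℕ.+ x′ ≡ x → x′ ≡ x
    x′≡x n′ {x′} x≤x′ eq = ℕ.≤-antisym (ℕ.≤-trans (ℕ.m≤n+m x′ n′) (ℕ.≤-reflexive eq)) x≤x′

  -- Either no unit is moved, so that `x′` is `x`, or at least one is, and it may be moved at once.
  -- The functional hypothesis makes the alternatives disjoint.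
  grow-suc : (∀ {n x n′ x′ a} → R n x a → R n′ x′ a → x ≡ x′) →
             ∀ {n x} → Listing (R (suc n) x) → Listing (Grow R n (suc x)) →
             Listing (Grow R (suc n) x)
  grow-suc functional {n} {x} L M = listing-⇔
    [ (λ r → suc n , x , ℕ.≤-refl , refl , r)
    , (λ (n′ , x′ , x<x′ , eq , r) → n′ , x′ , ℕ.<⇒≤ x<x′ , trans eq (ℕ.+-suc n x) , r)
    ]′
    (λ (n′ , x′ , x≤x′ , eq , r) → case ℕ.m≤n⇒m<n∨m≡n x≤x′ of λ where
      (inj₁ x<x′) → inj₂ (n′ , x′ , x<x′ , trans eq (sym (ℕ.+-suc n x)) , r)
      (inj₂ refl) → inj₁ (subst (λ n → R n x _) (ℕ.+-cancelʳ-≡ x n′ (suc n) eq) r))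
    (listing-⊎ (λ r (_ , x′ , x<x′ , _ , r′) → ℕ.<⇒≢ x<x′ (functional r r′)) L M)

-- `n` is the area remaining to the right of the column `K`.
data Placed (s : ℕ) (K : Shape) (n : ℕ) : Tail s → Set where
  placed : ∀ d {t} → tailArea t ≡ n → Placed s K n (next K d t)

Solid : (s n x : ℕ) → Tail s → Set
Solid s n x = Placed s (solid x) n

Upper : (s x n y : ℕ) → Tail s → Set
Upper s x n y = Placed s (holed x y) n

-- The successor pays for one cell of the upper part, which has `y + 1` cells. The remaining `m` is
-- shared between `y` and the columns further right by a second `Grow`.
Holed : (s n x : ℕ) → Tail s → Set
Holed s n x t = ∃[ m ] n ≡ suc m × Grow (Upper s x) m 0 t

solid-functional : ∀ {s n x n′ x′ t} → Solid s n x t → Solid s n′ x′ t → x ≡ x′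
solid-functional (placed _ _) (placed _ _) = refl

upper-functional : ∀ {s x n y n′ y′ t} → Upper s x n y t → Upper s x n′ y′ t → y ≡ y′
upper-functional (placed _ _) (placed _ _) = refl

holed-functional : ∀ {s n x n′ x′ t} → Holed s n x t → Holed s n′ x′ t → x ≡ x′
holed-functional (_ , _ , _ , _ , _ , _ , placed _ _) (_ , _ , _ , _ , _ , _ , placed _ _) = refl

place : ∀ s K {n} → Listing (λ t → tailArea {extent K} t ≡ n) → Listing (Placed s K n)
place s K L = record
  { list     = cartesianProductWith (next K) (allFin (placements s K)) list
  ; distinct = Unique.cartesianProductWith⁺ (next K) (λ where refl → refl , refl)
                 (Unique.allFin⁺ (placements s K)) distinct
  ; sound    = λ t∈ →
      case ∈-cartesianProductWith⁻ (next K) (allFin (placements s K)) list t∈ of λ where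
        (d , t , _ , t∈ , refl) → placed d (sound t∈)
  ; complete = λ where
      (placed d eq) → ∈-cartesianProductWith⁺ (next K) (∈-allFin d) (complete eq)
  }
  where open Listing L

empty-tail : ∀ {s} (t : Tail s) → tailArea t ≡ 0 → t ∈ end ∷ []
empty-tail end                    _ = here refl
empty-tail (next (solid _)   _ _) ()
empty-tail (next (holed _ _) _ _) ()

solid-not-holed : ∀ {s n x t} → Grow (Solid s) n x t → ¬ Grow (Holed s) n x t
solid-not-holed (_ , _ , _ , _ , placed _ _) (_ , _ , _ , _ , _ , _ , _ , _ , _ , _ , ())

solid-area : ∀ {s n t} → Grow (Solid s) n 0 t → tailArea t ≡ suc n
solid-area {n = n} (_ , x , _ , eq , placed _ {t} refl) =
  cong suc (trans (ℕ.+-comm x (tailArea t)) (trans eq (ℕ.+-identityʳ n)))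

regroup : ∀ x y a → suc x ℕ.+ suc y ℕ.+ a ≡ suc (suc (a ℕ.+ y) ℕ.+ x)
regroup = ℕ-Solver.solve-∀

holed-area : ∀ {s n t} → Grow (Holed s) n 0 t → tailArea t ≡ suc n
holed-area {n = n} (_ , x , _ , eq , m , refl , _ , y , _ , eq′ , placed _ {t} refl) =
  trans (regroup x y (tailArea t)) (cong suc
    (trans (cong (λ z → suc z ℕ.+ x) (trans eq′ (ℕ.+-identityʳ m)))
           (trans eq (ℕ.+-identityʳ n))))

split-tail : ∀ {s n} (t : Tail s) → tailArea t ≡ suc n →
             Grow (Solid s) n 0 t ⊎ Grow (Holed s) n 0 t
split-tail {n = n} (next (solid x) d t) eq = inj₁ (_ , x , ℕ.z≤n ,
  trans (ℕ.+-comm (tailArea t) x) (trans (ℕ.suc-injective eq) (sym (ℕ.+-identityʳ n))) ,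
  placed d refl)
split-tail {n = n} (next (holed x y) d t) eq = inj₂ (_ , x , ℕ.z≤n ,
  trans (ℕ.suc-injective (trans (sym (regroup x y (tailArea t))) eq)) (sym (ℕ.+-identityʳ n)) ,
  _ , refl , _ , y , ℕ.z≤n , sym (ℕ.+-identityʳ _) , placed d refl)

-- `tails` spends one unit on a cell of the next column before calling `solids` and `holeds`. Since
-- `solids` and `uppers` may return to `tails` with the area unchanged, this unit is what makes the
-- recursion terminate.
tails  : ∀ n s → Listing (λ t → tailArea {s} t ≡ n)
solids : ∀ n s x → Listing (Grow (Solid s) n x)
uppers : ∀ n s x y → Listing (Grow (Upper s x) n y)
holeds : ∀ n s x → Listing (Grow (Holed s) n x)

tails zero s = record
  { list     = end ∷ []
  ; distinct = [] ∷ []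
  ; sound    = λ where (here refl) → refl
  ; complete = empty-tail _
  }
tails (suc n) s = listing-⇔ [ solid-area , holed-area ]′ (split-tail _)
  (listing-⊎ solid-not-holed (solids n s 0) (holeds n s 0))

solids zero    s x = grow-zero (place s (solid x) (tails zero x))
solids (suc n) s x =
  grow-suc solid-functional (place s (solid x) (tails (suc n) x)) (solids n s (suc x))

uppers zero    s x y = grow-zero (place s (holed x y) (tails zero _))
uppers (suc n) s x y =
  grow-suc upper-functional (place s (holed x y) (tails (suc n) _)) (uppers n s x (suc y))

holeds zero    s x = grow-zero (listing-∅ λ where (_ , () , _))
holeds (suc n) s x = grow-suc holed-functional
  (listing-⇔ (λ g → n , refl , g) (λ where (_ , refl , g) → g) (uppers n s x 0))
  (holeds n s (suc x))

data First (n x : ℕ) : Code → Set where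
  starting : ∀ {t} → tailArea t ≡ n → First n x (x , t)

first-functional : ∀ {n x n′ x′ c} → First n x c → First n′ x′ c → x ≡ x′
first-functional (starting _) (starting _) = refl

start-with : ∀ x {n} → Listing (λ t → tailArea {x} t ≡ n) → Listing (First n x)
start-with x L = record
  { list     = map (_,_ x) list
  ; distinct = Unique.map⁺ (λ where refl → refl) distinct
  ; sound    = λ c∈ → case ∈-map⁻ (_,_ x) c∈ of λ where
      (t , t∈ , refl) → starting (sound t∈)
  ; complete = λ where (starting eq) → ∈-map⁺ (_,_ x) (complete eq)
  }
  where open Listing L

firsts : ∀ n x → Listing (Grow First n x)
firsts zero    x = grow-zero (start-with x (tails zero x))
firsts (suc n) x = grow-suc first-functional (start-with x (tails (suc n) x)) (firsts n (suc x))

first-area : ∀ {n c} → Grow First n 0 c → codeArea c ≡ suc n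
first-area {n} (_ , x , _ , eq , starting {t} refl) =
  cong suc (trans (ℕ.+-comm x (tailArea t)) (trans eq (ℕ.+-identityʳ n)))

split-code : ∀ {n} c → codeArea c ≡ suc n → Grow First n 0 c
split-code {n} (x , t) eq = _ , x , ℕ.z≤n ,
  trans (ℕ.+-comm (tailArea t) x) (trans (ℕ.suc-injective eq) (sym (ℕ.+-identityʳ n))) ,
  starting refl

codes : ∀ n → Listing (λ c → codeArea c ≡ n)
codes zero    = listing-∅ λ ()
codes (suc n) = listing-⇔ first-area (split-code _) (firsts n 0)

-- Counting

-- As polynomials in s, x and y, the numbers of codes enumerated above have
-- coefficients that are combinations of α n, β n and γ n.
α β γ : ℕ → ℕ
α zero    = 1
α (suc n) = 3 ℕ.* α n ℕ.+ 2 ℕ.* β n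
β zero    = 0
β (suc n) = α n ℕ.+ 2 ℕ.* β n ℕ.+ γ n
γ zero    = 0
γ (suc n) = β n ℕ.+ γ n

length-cartesianProductWith : ∀ {A B C : Set} (k : A → B → C) xs ys →
  length (cartesianProductWith k xs ys) ≡ length xs ℕ.* length ys
length-cartesianProductWith k []       ys = refl
length-cartesianProductWith k (x ∷ xs) ys = trans (length-++ (map (k x) ys))
  (cong₂ ℕ._+_ (length-map (k x) ys) (length-cartesianProductWith k xs ys))

count-place : ∀ s K {n} (L : Listing (λ t → tailArea {extent K} t ≡ n)) →
              count (place s K L) ≡ placements s K ℕ.* count L
count-place s K L = trans (length-cartesianProductWith (next K) (allFin (placements s K)) _)
  (cong (ℕ._* count L) (length-tabulate {n = placements s K} id))

open ≡-Reasoning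

-- A column contributes its number of placements times a count affine in its extent. For a solid
-- column this is quadratic in `x`, and for a holed one it is a multiple of `s`; at `x = 0` the sum
-- is again affine in `s`, which closes the induction. The parameters `x` and `y` stay general
-- because growth raises them. Each `identity` equates the two alternatives of `grow-suc` with the
-- closed form at `suc n`.
count-tails  : ∀ n s → count (tails (suc n) s) ≡
  2 ℕ.* α n ℕ.+ β n ℕ.+ s ℕ.* (α n ℕ.+ β n ℕ.+ γ n)
count-solids : ∀ n s x → count (solids n s x) ≡
  2 ℕ.* α n ℕ.+ β n ℕ.+ (α n ℕ.+ 2 ℕ.* β n ℕ.+ γ n) ℕ.* x ℕ.+ β n ℕ.* (x ℕ.* x) ℕ.+
  s ℕ.* (α n ℕ.+ β n ℕ.* x)
count-uppers : ∀ n s x y → count (uppers n s x y) ≡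
  s ℕ.* (α n ℕ.+ 2 ℕ.* β n ℕ.+ β n ℕ.* (x ℕ.+ y))
count-holeds : ∀ n s x → count (holeds n s x) ≡
  s ℕ.* (β n ℕ.+ γ n ℕ.+ γ n ℕ.* x)

count-tails n s = begin
  count (tails (suc n) s)
    ≡⟨ length-++ (Listing.list (solids n s 0)) ⟩
  count (solids n s 0) ℕ.+ count (holeds n s 0)
    ≡⟨ cong₂ ℕ._+_ (count-solids n s 0) (count-holeds n s 0) ⟩
  _
    ≡⟨ identity (α n) (β n) (γ n) s ⟩
  _ ∎
  where
  identity : ∀ f g h s →
    2 ℕ.* f ℕ.+ g ℕ.+ (f ℕ.+ 2 ℕ.* g ℕ.+ h) ℕ.* 0 ℕ.+ g ℕ.* 0 ℕ.+ s ℕ.* (f ℕ.+ g ℕ.* 0)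
      ℕ.+ s ℕ.* (g ℕ.+ h ℕ.+ h ℕ.* 0) ≡
    2 ℕ.* f ℕ.+ g ℕ.+ s ℕ.* (f ℕ.+ g ℕ.+ h)
  identity = ℕ-Solver.solve-∀

count-solids zero s x = trans (count-place s (solid x) (tails 0 x)) (identity s x)
  where
  identity : ∀ s x → (2 ℕ.+ s ℕ.+ x) ℕ.* 1 ≡ 2 ℕ.+ (1 ℕ.* x) ℕ.+ 0 ℕ.+ s ℕ.* 1
  identity = ℕ-Solver.solve-∀
count-solids (suc n) s x = begin
  count (solids (suc n) s x)
    ≡⟨ length-++ (Listing.list (place s (solid x) (tails (suc n) x))) ⟩
  count (place s (solid x) (tails (suc n) x)) ℕ.+ count (solids n s (suc x))
    ≡⟨ cong₂ ℕ._+_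
         (trans (count-place s (solid x) (tails (suc n) x))
                (cong ((2 ℕ.+ s ℕ.+ x) ℕ.*_) (count-tails n x)))
         (count-solids n s (suc x)) ⟩
  _
    ≡⟨ identity (α n) (β n) (γ n) s x ⟩
  _ ∎
  where
  identity : ∀ f g h s x →
    (2 ℕ.+ s ℕ.+ x) ℕ.* (2 ℕ.* f ℕ.+ g ℕ.+ x ℕ.* (f ℕ.+ g ℕ.+ h)) ℕ.+
    (2 ℕ.* f ℕ.+ g ℕ.+ (f ℕ.+ 2 ℕ.* g ℕ.+ h) ℕ.* (1 ℕ.+ x) ℕ.+ g ℕ.* ((1 ℕ.+ x) ℕ.* (1 ℕ.+ x)) ℕ.+
      s ℕ.* (f ℕ.+ g ℕ.* (1 ℕ.+ x))) ≡
    2 ℕ.* (3 ℕ.* f ℕ.+ 2 ℕ.* g) ℕ.+ (f ℕ.+ 2 ℕ.* g ℕ.+ h) ℕ.+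
      (3 ℕ.* f ℕ.+ 2 ℕ.* g ℕ.+ 2 ℕ.* (f ℕ.+ 2 ℕ.* g ℕ.+ h) ℕ.+ (g ℕ.+ h)) ℕ.* x ℕ.+
      (f ℕ.+ 2 ℕ.* g ℕ.+ h) ℕ.* (x ℕ.* x) ℕ.+
      s ℕ.* (3 ℕ.* f ℕ.+ 2 ℕ.* g ℕ.+ (f ℕ.+ 2 ℕ.* g ℕ.+ h) ℕ.* x)
  identity = ℕ-Solver.solve-∀

count-uppers zero s x y = count-place s (holed x y) (tails 0 _)
count-uppers (suc n) s x y = begin
  count (uppers (suc n) s x y)
    ≡⟨ length-++ (Listing.list (place s (holed x y) (tails (suc n) _))) ⟩
  count (place s (holed x y) (tails (suc n) _)) ℕ.+ count (uppers n s x (suc y))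
    ≡⟨ cong₂ ℕ._+_
         (trans (count-place s (holed x y) (tails (suc n) _)) (cong (s ℕ.*_) (count-tails n _)))
         (count-uppers n s x (suc y)) ⟩
  _
    ≡⟨ identity (α n) (β n) (γ n) s x y ⟩
  _ ∎
  where
  identity : ∀ f g h s x y →
    s ℕ.* (2 ℕ.* f ℕ.+ g ℕ.+ (2 ℕ.+ x ℕ.+ y) ℕ.* (f ℕ.+ g ℕ.+ h)) ℕ.+
    s ℕ.* (f ℕ.+ 2 ℕ.* g ℕ.+ g ℕ.* (x ℕ.+ (1 ℕ.+ y))) ≡
    s ℕ.* (3 ℕ.* f ℕ.+ 2 ℕ.* g ℕ.+ 2 ℕ.* (f ℕ.+ 2 ℕ.* g ℕ.+ h) ℕ.+
      (f ℕ.+ 2 ℕ.* g ℕ.+ h) ℕ.* (x ℕ.+ y))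
  identity = ℕ-Solver.solve-∀

count-holeds zero s x = sym (ℕ.*-zeroʳ s)
count-holeds (suc n) s x = begin
  count (holeds (suc n) s x)
    ≡⟨ length-++ (Listing.list (uppers n s x 0)) ⟩
  count (uppers n s x 0) ℕ.+ count (holeds n s (suc x))
    ≡⟨ cong₂ ℕ._+_ (count-uppers n s x 0) (count-holeds n s (suc x)) ⟩
  _
    ≡⟨ identity (α n) (β n) (γ n) s x ⟩
  _ ∎
  where
  identity : ∀ f g h s x →
    s ℕ.* (f ℕ.+ 2 ℕ.* g ℕ.+ g ℕ.* (x ℕ.+ 0)) ℕ.+ s ℕ.* (g ℕ.+ h ℕ.+ h ℕ.* (1 ℕ.+ x)) ≡
    s ℕ.* (f ℕ.+ 2 ℕ.* g ℕ.+ h ℕ.+ (g ℕ.+ h) ℕ.+ (g ℕ.+ h) ℕ.* x)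
  identity = ℕ-Solver.solve-∀

-- This gives `α` and `β` their meaning: `α n` counts the codes of area `n + 1`, and `β n` is the
-- sum of the slopes in `s` of `count (tails m s)` over `m ≤ n`. Accordingly `γ n` is the sum of
-- `β m` over `m < n`.
count-firsts : ∀ n x → count (firsts n x) ≡ α n ℕ.+ β n ℕ.* x
count-firsts zero x = refl
count-firsts (suc n) x = begin
  count (firsts (suc n) x)
    ≡⟨ length-++ (Listing.list (start-with x (tails (suc n) x))) ⟩
  count (start-with x (tails (suc n) x)) ℕ.+ count (firsts n (suc x))
    ≡⟨ cong₂ ℕ._+_
         (trans (length-map {B = Code} (_,_ x) (Listing.list (tails (suc n) x)))
                (count-tails n x))
         (count-firsts n (suc x)) ⟩
  _
    ≡⟨ identity (α n) (β n) (γ n) x ⟩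
  _ ∎
  where
  identity : ∀ f g h x →
    2 ℕ.* f ℕ.+ g ℕ.+ x ℕ.* (f ℕ.+ g ℕ.+ h) ℕ.+ (f ℕ.+ g ℕ.* (1 ℕ.+ x)) ≡
    3 ℕ.* f ℕ.+ 2 ℕ.* g ℕ.+ (f ℕ.+ 2 ℕ.* g ℕ.+ h) ℕ.* x
  identity = ℕ-Solver.solve-∀

count-codes : ∀ n → count (codes (suc n)) ≡ α n
count-codes n = trans (count-firsts n 0)
  (trans (cong (α n ℕ.+_) (ℕ.*-zeroʳ (β n))) (ℕ.+-identityʳ (α n)))

-- From listings of codes to the cardinality of the setoid

lookup-injective : ∀ {A : Set} {xs : List A} → Unique xs → ∀ i j →
                   lookup xs i ≡ lookup xs j → i ≡ j
lookup-injective (x∉ ∷ u) Fin.zero    Fin.zero    _  = refl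
lookup-injective (x∉ ∷ u) Fin.zero    (Fin.suc j) eq = contradiction eq (All.lookup x∉ (∈-lookup j))
lookup-injective (x∉ ∷ u) (Fin.suc i) Fin.zero    eq = contradiction (sym eq) (All.lookup x∉ (∈-lookup i))
lookup-injective (x∉ ∷ u) (Fin.suc i) (Fin.suc j) eq = cong Fin.suc (lookup-injective u i j eq)

module _ {a ℓ} (S : Setoid a ℓ) where
  private module S = Setoid S

  hasCardinality : ∀ {k} (at : Fin k → S.Carrier) →
                   (∀ {i j} → at i S.≈ at j → i ≡ j) → (∀ x → ∃[ i ] at i S.≈ x) →
                   HasCardinality S k
  hasCardinality at injective surjective = record
    { to        = index
    ; from      = at
    ; to-cong   = λ x≈y → injective (S.trans (at-index _) (S.trans x≈y (S.sym (at-index _))))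
    ; from-cong = λ where refl → S.refl
    ; inverse   = (λ y≈at-i → injective (S.trans (at-index _) y≈at-i)) ,
                  (λ where refl → at-index _)
    }
    where
    index : S.Carrier → Fin _
    index x = proj₁ (surjective x)
    at-index : ∀ x → at (index x) S.≈ x
    at-index x = proj₂ (surjective x)

cheesy-cardinality : ∀ {n} (L : Listing (λ c → codeArea c ≡ n)) →
                     HasCardinality (cheesySetoid 1 n) (count L)
cheesy-cardinality {n} L = hasCardinality (cheesySetoid 1 n) at
  (λ {i} {j} eq → lookup-injective distinct i j
    (polyomino-injective (lookup list i) (lookup list j) eq))
  surjective
  where
  open Listing L using (list; distinct; sound; complete)

  at : Fin (count L) → Setoid.Carrier (cheesySetoid 1 n)
  at i = polyomino code , polyomino-cheesy code ,
         trans (length-codeCells 0ℤ 0ℤ code) (sound (∈-lookup i))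
    where
    code : Code
    code = lookup list i

  locate : ∀ P code → polyomino code ≈ P → area P ≡ n → ∃[ i ] polyomino (lookup list i) ≈ P
  locate P code eq area≡n = Any.index code∈ , subst (λ c → polyomino c ≈ P) (lookup-index code∈) eq
    where
    code∈ : code ∈ list
    code∈ = complete (trans (sym (length-codeCells 0ℤ 0ℤ code))
                            (trans (≈⇒area≡ (polyomino code) P eq) area≡n))

  surjective : ∀ x → ∃[ i ] polyomino (lookup list i) ≈ proj₁ x
  surjective (P , C , area≡n) =
    let code , eq = polyomino-surjective P C in locate P code eq area≡n

-- The generating function

cheesySeries : Series
cheesySeries zero    = 0ℤ
cheesySeries (suc n) = + α n

cheesySeries-counts : IsGeneratingFunction (cheesySetoid 1) cheesySeries
cheesySeries-counts n = count (codes n) , cheesy-cardinality (codes n) , series≡count n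
  where
  series≡count : ∀ n → cheesySeries n ≡ + count (codes n)
  series≡count zero    = refl
  series≡count (suc n) = cong +_ (sym (count-codes n))

denominator-⊛ : ∀ u n → (poly (+ 1 ∷ - (+ 6) ∷ + 8 ∷ - (+ 1) ∷ []) ⊛ u) (3 ℕ.+ n) ≡
  u (3 ℕ.+ n) + + 8 * u (1 ℕ.+ n) - (+ 6 * u (2 ℕ.+ n) + u n)
denominator-⊛ u n = trans
  (cong (λ z → + 1 * u (3 ℕ.+ n) + (- (+ 6) * u (2 ℕ.+ n) +
                 (+ 8 * u (1 ℕ.+ n) + (- (+ 1) * u n + z))))
        -- The denominator has no coefficients beyond degree 3, so the remaining `n` terms of the
        -- convolution vanish.
        (sum-replicate-zero n))
  (rearrange (u (3 ℕ.+ n)) (u (2 ℕ.+ n)) (u (1 ℕ.+ n)) (u n))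
  where
  rearrange : ∀ a b c d → + 1 * a + (- (+ 6) * b + (+ 8 * c + (- (+ 1) * d + 0ℤ))) ≡
                          a + + 8 * c - (+ 6 * b + d)
  rearrange = solve-∀

-- The Cayley-Hamilton relation of the matrix with rows (3, 2, 0), (1, 2, 1), (0, 1, 1) that
-- advances `α`, `β` and `γ`, with negative terms moved across to stay in the natural numbers.
α-recurrence : ∀ n → α (3 ℕ.+ n) ℕ.+ 8 ℕ.* α (1 ℕ.+ n) ≡ 6 ℕ.* α (2 ℕ.+ n) ℕ.+ α n
α-recurrence n = identity (α n) (β n) (γ n)
  where
  identity : ∀ f g h →
    let f′ = 3 ℕ.* f ℕ.+ 2 ℕ.* g
        g′ = f ℕ.+ 2 ℕ.* g ℕ.+ h
        h′ = g ℕ.+ h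
        f″ = 3 ℕ.* f′ ℕ.+ 2 ℕ.* g′
        g″ = f′ ℕ.+ 2 ℕ.* g′ ℕ.+ h′
    in 3 ℕ.* f″ ℕ.+ 2 ℕ.* g″ ℕ.+ 8 ℕ.* f′ ≡ 6 ℕ.* f″ ℕ.+ f
  identity = ℕ-Solver.solve-∀

cheesySeries-recurrence : ∀ n →
  cheesySeries (4 ℕ.+ n) + + 8 * cheesySeries (2 ℕ.+ n) ≡
  + 6 * cheesySeries (3 ℕ.+ n) + cheesySeries (1 ℕ.+ n)
cheesySeries-recurrence n = begin
  + α (3 ℕ.+ n) + + 8 * + α (1 ℕ.+ n)
    ≡⟨ cong (_+_ (+ α (3 ℕ.+ n))) (ℤ.pos-* 8 (α (1 ℕ.+ n))) ⟨
  + (α (3 ℕ.+ n) ℕ.+ 8 ℕ.* α (1 ℕ.+ n))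
    ≡⟨ cong +_ (α-recurrence n) ⟩
  + (6 ℕ.* α (2 ℕ.+ n) ℕ.+ α n)
    ≡⟨ cong (λ z → z + + α n) (ℤ.pos-* 6 (α (2 ℕ.+ n))) ⟩
  + 6 * + α (2 ℕ.+ n) + + α n ∎

proposition2 : ∃[ C₁ ] IsGeneratingFunction (cheesySetoid 1) C₁
    × C₁ ≗ poly (+ 0 ∷ + 1 ∷ []) ⊛ poly (+ 1 ∷ - (+ 3) ∷ + 1 ∷ [])
    / poly (+ 1 ∷ - (+ 6) ∷ + 8 ∷ - (+ 1) ∷ [])
proposition2 = cheesySeries , cheesySeries-counts , refl , λ where
  -- The numerator has degree 3, so the coefficients up to 3 are compared by evaluation. From 4 on
  -- the numerator vanishes, and 4 is also where the recurrence starts, because the series is `α`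
  -- shifted by one.
  0 → refl
  1 → refl
  2 → refl
  3 → refl
  (suc (suc (suc (suc n)))) → begin
    _ ≡⟨ denominator-⊛ cheesySeries (suc n) ⟩
    _ ≡⟨ ℤ.i≡j⇒i-j≡0 (cheesySeries-recurrence n) ⟩
    -- The two leading zeros are the terms from the coefficients 0 and 1 of the factor q; the second
    -- vanishes because the other factor has degree 2.
    0ℤ ≡⟨ cong (λ z → 0ℤ + (0ℤ + z)) (sum-replicate-zero (3 ℕ.+ n)) ⟨
    _ ∎
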